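{- Let $n$ be a positive integer and let $$\psi(x)=\sum_{\pi\in\mathfrak{B}_n}\binom{x+n-\operatorname{ades}(\pi)}{n}\,\pi,\qquad \phi(x)=\sum_{\pi\in\mathfrak{B}_n}\binom{x+n-\operatorname{des}(\pi)}{n}\,\pi,$$ polynomials in $x$ with coefficients in the group algebra $\mathbb{Q}[\mathfrak{B}_n]$ of the hyperoctahedral group. Then, as polynomials in $x$ and $y$ with coefficients in $\mathbb{Q}[\mathfrak{B}_n]$, $$\psi(x)\phi(y)=\psi(2xy+x),$$ or, upon substituting $x\leftarrow x/2$ and $y\leftarrow (y-1)/2$, $$\psi(x/2)\,\phi((y-1)/2)=\psi(xy/2).$$
   Context: $\mathfrak{B}_n$ is the hyperoctahedral group: the group, under composition $(\sigma\tau)(s)=\sigma(\tau(s))$, of all bijections $\pi$ of $\{ -n,\ldots,-1,0,1,\ldots,n\}$ with $\pi(-s)=-\pi(s)$ for $s=0,1,\ldots,n$ (so $\pi(0)=0$). For $\pi\in\mathfrak{B}_n$, the descent number $\operatorname{des}(\pi)$ is the number of $i\in\{0,1,\ldots,n-1\}$ with $\pi(i)>\pi(i+1)$. The augmented descent number $\operatorname{ades}(\pi)$ is the number of augmented descents of $\pi$, where $\pi$ has an augmented descent at position $i\in\{0,1,\ldots,n\}$ if $0\le i\le n-1$ and $\pi(i)>\pi(i+1)$, or if $i=n$ and $\pi(n)>0$. For a polynomial $p$, $\binom{p}{n}=\frac{p(p-1)\cdots(p-n+1)}{n!}$. The variables $x,y$ are commuting indeterminates that also commute with the elements of the group algebra.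 -}

module Defs where

open import Algebra.Bundles using (Group)
open import Algebra.Bundles.Raw using (RawRing)
open import Data.Fin.Base as Fin using (Fin; toℕ; fromℕ; fromℕ<; inject₁)
import Data.Fin.Properties as Fin
open import Data.Integer.Base as ℤ using (ℤ; +_; -[1+_]; ∣_∣)
import Data.Integer.Properties as ℤ
open import Data.List.Base
  using (List; []; _∷_; _++_; map; foldr; filter; length; upTo; allFin;
         cartesianProductWith; mapMaybe)
open import Data.List.Membership.Propositional using (_∈_; lose)
open import Data.List.Membership.Propositional.Properties
  using (∈-map⁺; ∈-map⁻; ∈-++⁺ˡ; ∈-++⁺ʳ; ∈-allFin; ∈-cartesianProductWith⁺)
open import Data.List.Relation.Unary.All as All using ([]; _∷_)
open import Data.List.Relation.Unary.AllPairs using ([]; _∷_)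
open import Data.List.Relation.Unary.Any as Any using (here)
import Data.List.Relation.Unary.Any.Properties as Any
import Data.List.Relation.Unary.Enumerates.Setoid as Enumerates
import Data.List.Relation.Unary.Unique.Setoid as UniqueSetoid
open import Data.List.Relation.Unary.Unique.Propositional using (Unique)
import Data.List.Relation.Unary.Unique.Propositional.Properties as Unique
open import Data.Maybe.Base as Maybe using (Maybe; just; nothing)
import Data.Maybe.Relation.Unary.Any as MaybeAny
open import Data.Nat.Base as ℕ using (ℕ; zero; suc; z≤n; _!)
import Data.Nat.Properties as ℕ
open import Data.Product.Base using (∃; _×_; _,_; proj₁; proj₂)
open import Data.Rational.Base as ℚ using (ℚ; 0ℚ; 1ℚ)
open import Data.Sum.Base using (_⊎_)
open import Data.Vec.Base as Vec using (Vec; []; _∷_)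
import Data.Vec.Properties as Vec
open import Function.Base using (_∘_)
open import Function.Bundles using (_↔_; Inverse; mk⤖)
open import Function.Construct.Composition using (_↔-∘_)
open import Function.Construct.Identity using (↔-id)
open import Function.Construct.Symmetry using (↔-sym)
open import Function.Definitions using (Injective; Surjective; Bijective)
open import Function.Properties.Bijection using (⤖⇒↔)
open import Level using (Level; 0ℓ)
open import Relation.Binary.Definitions using (Decidable; DecidableEquality)
open import Relation.Binary.PropositionalEquality
  using (_≡_; refl; sym; trans; cong; subst)
open import Relation.Nullary.Decidable
  using (Dec; yes; no; map′; _×-dec_; _⊎-dec_; _→-dec_; dec⇒maybe)
open import Relation.Nullary.Negation using (¬_; contradiction)
import Relation.Unary as Unary

private variable
  c ℓ : Level
  n : ℕ

-- {-n, …, -1, 0, 1, …, n}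
record ±[_] (n : ℕ) : Set where
  constructor mk±
  field
    value    : ℤ
    .bounded : ∣ value ∣ ℕ.≤ n

open ±[_] public using (value)

value-injective : {s t : ±[ n ]} → value s ≡ value t → s ≡ t
value-injective refl = refl

infix 4 _≟±_

_≟±_ : DecidableEquality ±[ n ]
s ≟± t = map′ value-injective (cong value) (value s ℤ.≟ value t)

neg : ±[ n ] → ±[ n ]
neg (mk± z b) = mk± (ℤ.- z) (subst (ℕ._≤ _) (sym (ℤ.∣-i∣≡∣i∣ z)) b)

neg-involutive : (s : ±[ n ]) → neg (neg s) ≡ s
neg-involutive s = value-injective (ℤ.neg-involutive (value s))

at : Fin (suc n) → ±[ n ]
at i = mk± (+ toℕ i) (Fin.toℕ≤pred[n] i)

points : ∀ n → List ±[ n ]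
points n = map at (allFin (suc n)) ++ map (neg ∘ at ∘ Fin.suc) (allFin n)

points-enumerates : (s : ±[ n ]) → s ∈ points n
points-enumerates {n} (mk± (+ k) k≤n) =
  subst (_∈ points n)
    (value-injective (cong +_ (Fin.toℕ-fromℕ< (ℕ.s≤s k≤n))))
    (∈-++⁺ˡ (∈-map⁺ at (∈-allFin (fromℕ< (ℕ.s≤s k≤n)))))
points-enumerates {n} (mk± -[1+ k ] k<n) =
  subst (_∈ points n)
    (value-injective (cong -[1+_] (Fin.toℕ-fromℕ< k<n)))
    (∈-++⁺ʳ (map at (allFin (suc n)))
      (∈-map⁺ (neg ∘ at ∘ Fin.suc) (∈-allFin (fromℕ< k<n))))

points-unique : Unique (points n)
points-unique {n} = Unique.++⁺
  (Unique.map⁺ (Fin.toℕ-injective ∘ ℤ.+-injective ∘ cong value)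
    (Unique.allFin⁺ (suc n)))
  (Unique.map⁺ neg-at-injective
    (Unique.allFin⁺ n))
  λ (s∈l , s∈r) → disjoint (∈-map⁻ at s∈l) (∈-map⁻ (neg ∘ at ∘ Fin.suc) s∈r)
  where
  neg-at-injective : ∀ {i j : Fin n} → neg (at (Fin.suc i)) ≡ neg (at (Fin.suc j)) → i ≡ j
  neg-at-injective = Fin.toℕ-injective ∘ ℤ.-[1+-injective ∘ cong value

  disjoint : ∀ {s : ±[ n ]} → ∃ (λ i → i ∈ allFin (suc n) × s ≡ at i) →
             ¬ ∃ (λ i → i ∈ allFin n × s ≡ neg (at (Fin.suc i)))
  disjoint (_ , _ , refl) (_ , _ , ())

∀±? : {P : ±[ n ] → Set} → Unary.Decidable P → Dec (∀ s → P s)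
∀±? P? = map′ (λ all s → All.lookup all (points-enumerates s))
              (λ all → All.universal all _)
              (All.all? P? (points _))

∃±? : {P : ±[ n ] → Set} → Unary.Decidable P → Dec (∃ P)
∃±? P? = map′ Any.satisfied (λ (s , ps) → lose (points-enumerates s) ps)
              (Any.any? P? (points _))

record 𝔅 (n : ℕ) : Set where
  field
    bijection : ±[ n ] ↔ ±[ n ]

  open Inverse bijection public using (to; from)

  field
    odd : ∀ s → to (neg s) ≡ neg (to s)

open 𝔅 public using (bijection; odd)

infixl 20 _⟨$⟩_

_⟨$⟩_ : 𝔅 n → ±[ n ] → ±[ n ]
π ⟨$⟩ s = 𝔅.to π s

infix 4 _≈𝔅_

_≈𝔅_ : 𝔅 n → 𝔅 n → Set
σ ≈𝔅 τ = ∀ s → σ ⟨$⟩ s ≡ τ ⟨$⟩ s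

infix 4 _≟𝔅_

_≟𝔅_ : Decidable (_≈𝔅_ {n})
σ ≟𝔅 τ = ∀±? λ s → σ ⟨$⟩ s ≟± τ ⟨$⟩ s

𝔅-group : ℕ → Group 0ℓ 0ℓ
𝔅-group n = record
  { Carrier = 𝔅 n
  ; _≈_     = _≈𝔅_
  ; _∙_     = λ σ τ → record
    { bijection = bijection σ ↔-∘ bijection τ
    ; odd       = λ s → trans (cong (σ ⟨$⟩_) (odd τ s)) (odd σ (τ ⟨$⟩ s))
    }
  ; ε       = record { bijection = ↔-id ±[ n ] ; odd = λ _ → refl }
  ; _⁻¹     = λ σ → record
    { bijection = ↔-sym (bijection σ)
    ; odd       = from-odd σ
    }
  ; isGroup = record
    { isMonoid = record
      { isSemigroup = record
        { isMagma = record
          { isEquivalence = record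
            { refl  = λ _ → refl
            ; sym   = λ σ≈τ s → sym (σ≈τ s)
            ; trans = λ ρ≈σ σ≈τ s → trans (ρ≈σ s) (σ≈τ s)
            }
          ; ∙-cong = λ {ρ} {σ} {τ} ρ≈σ τ≈υ s →
              trans (cong (ρ ⟨$⟩_) (τ≈υ s)) (ρ≈σ _)
          }
        ; assoc = λ _ _ _ _ → refl
        }
      ; identity = (λ _ _ → refl) , (λ _ _ → refl)
      }
    ; inverse = from∘to , to∘from
    ; ⁻¹-cong = λ {σ} {τ} σ≈τ s →
        to-injective τ (trans (sym (σ≈τ (𝔅.from σ s)))
          (trans (to∘from σ s) (sym (to∘from τ s))))
    }
  }
  where
  to∘from : ∀ (σ : 𝔅 n) s → σ ⟨$⟩ 𝔅.from σ s ≡ s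
  to∘from σ = Inverse.strictlyInverseˡ (bijection σ)

  from∘to : ∀ (σ : 𝔅 n) s → 𝔅.from σ (σ ⟨$⟩ s) ≡ s
  from∘to σ = Inverse.strictlyInverseʳ (bijection σ)

  to-injective : ∀ (σ : 𝔅 n) {s t} → σ ⟨$⟩ s ≡ σ ⟨$⟩ t → s ≡ t
  to-injective σ eq =
    trans (sym (from∘to σ _)) (trans (cong (𝔅.from σ) eq) (from∘to σ _))

  from-odd : ∀ (σ : 𝔅 n) s → 𝔅.from σ (neg s) ≡ neg (𝔅.from σ s)
  from-odd σ s = to-injective σ (trans (to∘from σ (neg s))
    (sym (trans (odd σ (𝔅.from σ s)) (cong neg (to∘from σ s)))))

-- An element is determined by its window (π(1), …, π(n)).  Every vector
-- in ±[ n ]ⁿ extends uniquely to an odd self-map of ±[ n ]; the group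
-- consists of those extensions that are bijective.

extend : Vec ±[ n ] n → ±[ n ] → ±[ n ]
extend w (mk± (+ zero)  _)   = mk± (+ 0) z≤n
extend w (mk± (+ suc k) k<n) = Vec.lookup w (fromℕ< k<n)
extend w (mk± -[1+ k ]  k<n) = neg (Vec.lookup w (fromℕ< k<n))

extend-odd : (w : Vec ±[ n ] n) → ∀ s → extend w (neg s) ≡ neg (extend w s)
extend-odd w (mk± (+ zero)  _) = refl
extend-odd w (mk± (+ suc k) _) = refl
extend-odd w (mk± -[1+ k ]  _) = sym (neg-involutive _)

window : 𝔅 n → Vec ±[ n ] n
window π = Vec.tabulate λ i → π ⟨$⟩ at (Fin.suc i)

bijective? : (f : ±[ n ] → ±[ n ]) → Dec (Bijective _≡_ _≡_ f)
bijective? f = injective? ×-dec surjective?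
  where
  injective? : Dec (Injective _≡_ _≡_ f)
  injective? = map′ (λ inj {s} {t} → inj s t) (λ inj s t → inj)
    (∀±? λ s → ∀±? λ t → (f s ≟± f t) →-dec (s ≟± t))

  surjective? : Dec (Surjective _≡_ _≡_ f)
  surjective? = map′ strict⇒surjective surjective⇒strict
    (∀±? λ t → ∃±? λ s → f s ≟± t)
    where
    strict⇒surjective : (∀ t → ∃ λ s → f s ≡ t) → Surjective _≡_ _≡_ f
    strict⇒surjective sur t = proj₁ (sur t) , λ { refl → proj₂ (sur t) }

    surjective⇒strict : Surjective _≡_ _≡_ f → ∀ t → ∃ λ s → f s ≡ t
    surjective⇒strict sur t = proj₁ (sur t) , proj₂ (sur t) refl

fromBijective : (w : Vec ±[ n ] n) → Bijective _≡_ _≡_ (extend w) → 𝔅 n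
fromBijective w bij = record
  { bijection = ⤖⇒↔ (mk⤖ bij) ; odd = extend-odd w }

fromWindow : Vec ±[ n ] n → Maybe (𝔅 n)
fromWindow w = Maybe.map (fromBijective w) (dec⇒maybe (bijective? (extend w)))

vectors : {A : Set} → List A → ∀ k → List (Vec A k)
vectors xs zero    = [] ∷ []
vectors xs (suc k) = cartesianProductWith _∷_ xs (vectors xs k)

elements : ∀ n → List (𝔅 n)
elements n = mapMaybe fromWindow (vectors (points n) n)

vectors-enumerates : {A : Set} {xs : List A} → (∀ x → x ∈ xs) →
                     ∀ {k} (w : Vec A k) → w ∈ vectors xs k
vectors-enumerates enum []      = here refl
vectors-enumerates enum (x ∷ w) =
  ∈-cartesianProductWith⁺ _∷_ (enum x) (vectors-enumerates enum w)

vectors-unique : {A : Set} {xs : List A} → Unique xs → ∀ k → Unique (vectors xs k)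
vectors-unique xs! zero    = [] ∷ []
vectors-unique xs! (suc k) =
  Unique.cartesianProductWith⁺ _∷_ Vec.∷-injective xs! (vectors-unique xs! k)

0-fixed : (π : 𝔅 n) → π ⟨$⟩ at Fin.zero ≡ at Fin.zero
0-fixed π = value-injective (i≡-i⇒i≡0 (cong value (odd π (at Fin.zero))))
  where
  i≡-i⇒i≡0 : ∀ {i} → i ≡ ℤ.- i → i ≡ + 0
  i≡-i⇒i≡0 {+ zero} _ = refl

extend-window : (π : 𝔅 n) → ∀ s → extend (window π) s ≡ π ⟨$⟩ s
extend-window π (mk± (+ zero)  _)   = sym (0-fixed π)
extend-window π (mk± (+ suc k) k<n) = trans
  (Vec.lookup∘tabulate _ (fromℕ< k<n))
  (cong (π ⟨$⟩_) (value-injective (cong (+_ ∘ suc) (Fin.toℕ-fromℕ< k<n))))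
extend-window π (mk± -[1+ k ]  k<n) = trans
  (cong neg (Vec.lookup∘tabulate _ (fromℕ< k<n)))
  (trans (sym (odd π _))
    (cong (π ⟨$⟩_) (value-injective (cong -[1+_] (Fin.toℕ-fromℕ< k<n)))))

window-extend : (w : Vec ±[ n ] n) →
                Vec.tabulate (λ i → extend w (at (Fin.suc i))) ≡ w
window-extend w = trans
  (Vec.tabulate-cong λ i → cong (Vec.lookup w) (Fin.fromℕ<-toℕ i (Fin.toℕ<n i)))
  (Vec.tabulate∘lookup w)

elements-enumerates : Enumerates.IsEnumeration (Group.setoid (𝔅-group n)) (elements n)
elements-enumerates {n} π = Any.mapMaybe⁺ fromWindow (vectors (points n) n)
  (Any.map⁺ (lose (vectors-enumerates points-enumerates (window π)) found))
  where
  open Inverse (bijection π) using (strictlyInverseˡ; strictlyInverseʳ)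

  extend-bijective : Bijective _≡_ _≡_ (extend (window π))
  extend-bijective =
    (λ {s} {t} eq → trans (sym (strictlyInverseʳ s))
      (trans (cong (𝔅.from π)
               (trans (sym (extend-window π s)) (trans eq (extend-window π t))))
             (strictlyInverseʳ t))) ,
    (λ t → 𝔅.from π t ,
      λ { refl → trans (extend-window π _) (strictlyInverseˡ t) })

  found : MaybeAny.Any (π ≈𝔅_) (fromWindow (window π))
  found with bijective? (extend (window π))
  ... | yes _   = MaybeAny.just (λ s → sym (extend-window π s))
  ... | no ¬bij = contradiction extend-bijective ¬bij

elements-unique : UniqueSetoid.Unique (Group.setoid (𝔅-group n)) (elements n)
elements-unique {n} = mapMaybe! (vectors-unique points-unique n)
  where
  window-fromWindow : ∀ w {π : 𝔅 n} → fromWindow w ≡ just π → window π ≡ w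
  window-fromWindow w eq with bijective? (extend w)
  window-fromWindow w refl | yes _ = window-extend w

  mapMaybe-∉ : ∀ {w π ws} → fromWindow w ≡ just π → All.All (λ v → ¬ w ≡ v) ws →
               All.All (λ σ → ¬ π ≈𝔅 σ) (mapMaybe fromWindow ws)
  mapMaybe-∉ eq [] = []
  mapMaybe-∉ {w} {π} {v ∷ vs} eq (w≢v ∷ w∉vs) with fromWindow v in eq′
  ... | nothing = mapMaybe-∉ eq w∉vs
  ... | just σ  = (λ π≈σ → w≢v (trans (sym (window-fromWindow w eq))
                    (trans (Vec.tabulate-cong λ i → π≈σ _) (window-fromWindow v eq′))))
                  ∷ mapMaybe-∉ eq w∉vs

  mapMaybe! : ∀ {ws} → Unique ws →
              UniqueSetoid.Unique (Group.setoid (𝔅-group n)) (mapMaybe fromWindow ws)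
  mapMaybe! [] = []
  mapMaybe! {w ∷ ws} (w∉ws ∷ ws!) with fromWindow w in eq
  ... | nothing = mapMaybe! ws!
  ... | just π  = mapMaybe-∉ eq w∉ws ∷ mapMaybe! ws!

Descent : 𝔅 n → Fin n → Set
Descent π i = value (π ⟨$⟩ at (inject₁ i)) ℤ.> value (π ⟨$⟩ at (Fin.suc i))

descent? : (π : 𝔅 n) → Unary.Decidable (Descent π)
descent? π i = value (π ⟨$⟩ at (Fin.suc i)) ℤ.<? value (π ⟨$⟩ at (inject₁ i))

AugmentedDescent : 𝔅 n → Fin (suc n) → Set
AugmentedDescent {n} π i =
  (∃ λ j → i ≡ inject₁ j × Descent π j) ⊎
  (i ≡ fromℕ n × value (π ⟨$⟩ at (fromℕ n)) ℤ.> + 0)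

augmentedDescent? : (π : 𝔅 n) → Unary.Decidable (AugmentedDescent π)
augmentedDescent? {n} π i =
  Fin.any? (λ j → (i Fin.≟ inject₁ j) ×-dec descent? π j) ⊎-dec
  ((i Fin.≟ fromℕ n) ×-dec (+ 0 ℤ.<? value (π ⟨$⟩ at (fromℕ n))))

des : 𝔅 n → ℕ
des π = length (filter (descent? π) (allFin _))

ades : 𝔅 n → ℕ
ades π = length (filter (augmentedDescent? π) (allFin _))

-- Elements of ℚ[G] are formal sums Σ qᵢ·gᵢ, represented as lists of terms and
-- identified when every element of G has the same total coefficient.

module _ (G : Group c ℓ) (_≟_ : Decidable (Group._≈_ G)) where
  private module G = Group G

  coefficientAt : List (ℚ × G.Carrier) → G.Carrier → ℚ
  coefficientAt a g = foldr (λ (q , _) r → q ℚ.+ r) 0ℚ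
    (filter (λ (_ , h) → h ≟ g) a)

  groupAlgebra : RawRing c c
  groupAlgebra = record
    { Carrier = List (ℚ × G.Carrier)
    ; _≈_     = λ a b → ∀ g → coefficientAt a g ≡ coefficientAt b g
    ; _+_     = _++_
    ; _*_     = cartesianProductWith (λ (p , g) (q , h) → p ℚ.* q , g G.∙ h)
    ; -_      = map (λ (q , g) → ℚ.- q , g)
    ; 0#      = []
    ; 1#      = (1ℚ , G.ε) ∷ []
    }

-- The list a₀ ∷ a₁ ∷ … ∷ aₘ ∷ [] stands for a₀ + a₁ t + … + aₘ tᵐ;
-- trailing zeros are allowed,
-- and t commutes with the coefficients.

module Polynomial (R : RawRing c ℓ) where
  private module R = RawRing R

  coefficient : List R.Carrier → ℕ → R.Carrier
  coefficient []      _       = R.0#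
  coefficient (a ∷ p) zero    = a
  coefficient (a ∷ p) (suc k) = coefficient p k

  infixl 6 _+ₚ_
  infixl 7 _*ₚ_

  _+ₚ_ : List R.Carrier → List R.Carrier → List R.Carrier
  []      +ₚ q       = q
  (a ∷ p) +ₚ []      = a ∷ p
  (a ∷ p) +ₚ (b ∷ q) = a R.+ b ∷ p +ₚ q

  _*ₚ_ : List R.Carrier → List R.Carrier → List R.Carrier
  []      *ₚ q = []
  (a ∷ p) *ₚ q = map (a R.*_) q +ₚ (R.0# ∷ p *ₚ q)

  polynomials : RawRing c ℓ
  polynomials = record
    { Carrier = List R.Carrier
    ; _≈_     = λ p q → ∀ k → coefficient p k R.≈ coefficient q k
    ; _+_     = _+ₚ_
    ; _*_     = _*ₚ_
    ; -_      = map R.-_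
    ; 0#      = []
    ; 1#      = R.1# ∷ []
    }

  constant : R.Carrier → List R.Carrier
  constant a = a ∷ []

  variable-t : List R.Carrier
  variable-t = R.0# ∷ R.1# ∷ []

ℚ[𝔅_] : ℕ → RawRing 0ℓ 0ℓ
ℚ[𝔅 n ] = groupAlgebra (𝔅-group n) _≟𝔅_

ℚ[𝔅_][x] : ℕ → RawRing 0ℓ 0ℓ
ℚ[𝔅 n ][x] = Polynomial.polynomials ℚ[𝔅 n ]

ℚ[𝔅_][x,y] : ℕ → RawRing 0ℓ 0ℓ
ℚ[𝔅 n ][x,y] = Polynomial.polynomials ℚ[𝔅 n ][x]

module _ {n : ℕ} where
  open RawRing ℚ[𝔅 n ][x,y]

  infixl 6 _-_

  _-_ : Carrier → Carrier → Carrier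
  p - q = p + - q

  _·_ : ℚ → 𝔅 n → Carrier
  q · π = Polynomial.constant ℚ[𝔅 n ][x]
            (Polynomial.constant ℚ[𝔅 n ] ((q , π) ∷ []))

  scalar : ℚ → Carrier
  scalar q = q · Group.ε (𝔅-group n)

  natural : ℕ → Carrier
  natural k = scalar (+ k ℚ./ 1)

  x y : Carrier
  x = Polynomial.constant ℚ[𝔅 n ][x] (Polynomial.variable-t ℚ[𝔅 n ])
  y = Polynomial.variable-t ℚ[𝔅 n ][x]

  binomial : Carrier → ℕ → Carrier
  binomial p k = scalar ((+ 1 ℚ./ (k !)) {{k ℕ.!≢0}}) *
    foldr (λ i r → (p - natural i) * r) 1# (upTo k)

  Σ𝔅 : (𝔅 n → Carrier) → Carrier
  Σ𝔅 f = foldr (λ π r → f π + r) 0# (elements n)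

  -- For a polynomial p with rational coefficients, ψ p and φ p are the
  -- results of substituting p for the variable.
  ψ φ : Carrier → Carrier
  ψ p = Σ𝔅 λ π → binomial (p + natural n - natural (ades π)) n * (1ℚ · π)
  φ p = Σ𝔅 λ π → binomial (p + natural n - natural (des π)) n * (1ℚ · π)

-- A map b : {1, …, n} → ℤ, extended to an odd map, has a unique sorting element π ∈ 𝔅ₙ: the
-- sequence b(π(-n)), …, b(π(n)) is weakly increasing, and so is π along ties.  Counting the maps
-- sorted by a given element shows that φ(l) is the sum of sort(a) over all a with values in
-- [-l, l], and ψ(k) that of sort(b) over all b with values in [-k, k-1].  Reading the pair of
-- a ∘ sort(b)⁻¹ and b as the digits of 2k a ∘ sort(b)⁻¹ + b gives a bijection onto the maps with
-- values in [-(2kl+k), 2kl+k-1] that turns sort(b) sort(a) into the sorting element of the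
-- combined map.  So the identity holds at all naturals x = k > 0 and y = l, hence as an identity
-- of polynomials; the second form is obtained in the same way from x = 2k and y = 2l+1.

module Submission where

open import Defs
open import Algebra.Bundles using (Group; AbelianGroup)
open import Algebra.Bundles.Raw using (RawRing)
open import Algebra.Properties.Group using (∙-cancelˡ; ∙-cancelʳ; x∙y⁻¹≈ε⇒x≈y)
open import Data.Bool.Base using (if_then_else_; true; false)
open import Data.Fin.Base as Fin using (Fin; toℕ; fromℕ; fromℕ<; inject₁)
import Data.Fin.Properties as Fin
open import Data.Integer.Base as ℤ using (ℤ; -[1+_]; ∣_∣)
import Data.Integer.Properties as ℤ
import Data.Integer.Solver as ℤSolver
open import Data.List.Base
  using (List; []; _∷_; _++_; map; foldr; filter; length; allFin; tabulate; applyUpTo;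
         cartesianProductWith)
import Data.List.Properties as List
open import Data.List.Relation.Unary.All as All using (All; []; _∷_)
open import Data.List.Relation.Unary.AllPairs using ([]; _∷_)
open import Data.List.Relation.Unary.Any using (Any; here; there)
import Data.List.Relation.Unary.Enumerates.Setoid as Enumerates
import Data.List.Relation.Unary.Unique.Setoid as UniqueSetoid
open import Data.Nat.Base as ℕ using (ℕ; zero; suc; NonZero; _≤_; z≤n; s≤s; _!)
open import Data.Nat.Combinatorics using (_C_; nCk+nC[k+1]≡[n+1]C[k+1]; k>n⇒nCk≡0)
import Data.Nat.Properties as ℕ
import Data.Nat.Solver as ℕSolver
open import Data.Product.Base using (_×_; _,_; proj₁; proj₂; ∃)
open import Data.Product.Relation.Binary.Lex.Strict using (×-strictTotalOrder)
open import Data.Rational.Base as ℚ using (ℚ; 0ℚ; 1ℚ; ½; toℚᵘ)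
import Data.Rational.Properties as ℚ
import Data.Rational.Solver as ℚSolver
import Data.Rational.Unnormalised.Base as ℚᵘ
import Data.Rational.Unnormalised.Properties as ℚᵘ
open import Data.Sum.Base using (_⊎_; inj₁; inj₂)
open import Data.Unit.Base using (⊤; tt)
open import Data.Vec.Base as Vec using (Vec; []; _∷_)
import Data.Vec.Properties as Vec
open import Function.Base using (_∘_; _on_; id)
open import Function.Bundles using (Inverse; mk⤖)
open import Function.Definitions using (Injective)
open import Function.Properties.Bijection using (⤖⇒↔)
open import Level using (0ℓ; _⊔_)
open import Relation.Binary.Bundles using (Setoid; StrictTotalOrder)
open import Relation.Binary.Definitions using (Decidable; Trichotomous; tri<; tri≈; tri>)
open import Relation.Binary.PropositionalEquality
open import Relation.Nullary.Decidable using (Dec; yes; no; does; _×-dec_; recompute)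
open import Relation.Nullary.Negation using (¬_; contradiction)
import Relation.Unary as Unary

-- Evaluation of group algebra elements against functions on the group

-- Group algebra elements are lists compared through coefficients, and `𝔅 n` carries a pointwise
-- equality. Instead of ring laws for such lists, the proof uses pairings: an element is seen only
-- through the linear extensions of functions `F` on the group. A product pairs by nesting, ⟨ab, F⟩
-- = ⟨a, g ↦ ⟨b, h ↦ F(gh)⟩⟩, and the indicator of a class recovers a coefficient. Substituting
-- numbers for x and y extends the pairing to polynomials. At the chosen points the binomials take
-- natural values, so the identity becomes an equality of two weighted counts in ℕ.
--
-- The half-open range of b makes digits unambiguous: 2k a + b with b in [-k, k-1] is division by 2k
-- with a shifted remainder. The price is that the odd extension of b reaches k at negative points,
-- so neighbouring blocks of combined values touch at their endpoints; the delicate step is that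
-- these ties are still broken in the right order. Only positive k is used: for k = 0 the origin
-- itself would attain the value k.

module Pairings where
  open ℚSolver.+-*-Solver using (solve; _:+_; _:*_; _:-_; :-_; _:=_; con)

  module _ {c ℓ} (G : Group c ℓ) where
    private module G = Group G

    -- Elements of `R` act as linear functionals on rational-valued functions of the group, and the
    -- product law nests them as convolution does. The last three fields, which concern the function
    -- argument, let a coefficient be moved past an evaluated polynomial.
    record Pairing {r ℓ′} (R : RawRing r ℓ′) : Set (c ⊔ r) where
      private module R = RawRing R
      field
        ⟨_,_⟩    : R.Carrier → (G.Carrier → ℚ) → ℚ
        0-pair   : ∀ F → ⟨ R.0# , F ⟩ ≡ 0ℚ
        1-pair   : ∀ F → ⟨ R.1# , F ⟩ ≡ F G.ε
        +-pair   : ∀ a b F → ⟨ a R.+ b , F ⟩ ≡ ⟨ a , F ⟩ ℚ.+ ⟨ b , F ⟩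
        *-pair   : ∀ a b F → ⟨ a R.* b , F ⟩ ≡ ⟨ a , (λ g → ⟨ b , (λ h → F (g G.∙ h)) ⟩) ⟩
        neg-pair : ∀ a F → ⟨ R.- a , F ⟩ ≡ ℚ.- ⟨ a , F ⟩
        pair-cong   : ∀ a {F H} → (∀ g → F g ≡ H g) → ⟨ a , F ⟩ ≡ ⟨ a , H ⟩
        pair-0      : ∀ a → ⟨ a , (λ _ → 0ℚ) ⟩ ≡ 0ℚ
        pair-linear : ∀ a F q H →
          ⟨ a , (λ g → F g ℚ.+ q ℚ.* H g) ⟩ ≡ ⟨ a , F ⟩ ℚ.+ q ℚ.* ⟨ a , H ⟩

    -- Evaluation of polynomials in one further variable

    module _ {r ℓ′} {R : RawRing r ℓ′} (P : Pairing R) (u : ℚ) where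
      private module R = RawRing R
      open Pairing P
      open Polynomial R

      evalPairing : List R.Carrier → (G.Carrier → ℚ) → ℚ
      evalPairing []      F = 0ℚ
      evalPairing (a ∷ p) F = ⟨ a , F ⟩ ℚ.+ u ℚ.* evalPairing p F

      eval-+ : ∀ p q F → evalPairing (p +ₚ q) F ≡ evalPairing p F ℚ.+ evalPairing q F
      eval-+ []      q       F = sym (ℚ.+-identityˡ _)
      eval-+ (a ∷ p) []      F = sym (ℚ.+-identityʳ _)
      eval-+ (a ∷ p) (b ∷ q) F = trans
        (cong₂ (λ s t → s ℚ.+ u ℚ.* t) (+-pair a b F) (eval-+ p q F))
        (solve 5 (λ a b u s t → (a :+ b) :+ u :* (s :+ t) := (a :+ u :* s) :+ (b :+ u :* t)) refl
          ⟨ a , F ⟩ ⟨ b , F ⟩ u (evalPairing p F) (evalPairing q F))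

      eval-neg : ∀ p F → evalPairing (map R.-_ p) F ≡ ℚ.- evalPairing p F
      eval-neg []      F = refl
      eval-neg (a ∷ p) F = trans
        (cong₂ (λ s t → s ℚ.+ u ℚ.* t) (neg-pair a F) (eval-neg p F))
        (solve 3 (λ a u s → (:- a) :+ u :* (:- s) := :- (a :+ u :* s)) refl
          ⟨ a , F ⟩ u (evalPairing p F))

      eval-cong : ∀ p {F H} → (∀ g → F g ≡ H g) → evalPairing p F ≡ evalPairing p H
      eval-cong []      F≗H = refl
      eval-cong (a ∷ p) F≗H =
        cong₂ (λ s t → s ℚ.+ u ℚ.* t) (pair-cong a F≗H) (eval-cong p F≗H)

      eval-0 : ∀ p → evalPairing p (λ _ → 0ℚ) ≡ 0ℚ
      eval-0 []      = refl
      eval-0 (a ∷ p) = trans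
        (cong₂ (λ s t → s ℚ.+ u ℚ.* t) (pair-0 a) (eval-0 p))
        (trans (ℚ.+-identityˡ _) (ℚ.*-zeroʳ u))

      eval-linear : ∀ p F q H → evalPairing p (λ g → F g ℚ.+ q ℚ.* H g)
                              ≡ evalPairing p F ℚ.+ q ℚ.* evalPairing p H
      eval-linear []      F q H = sym (trans (ℚ.+-identityˡ _) (ℚ.*-zeroʳ q))
      eval-linear (a ∷ p) F q H = trans
        (cong₂ (λ s t → s ℚ.+ u ℚ.* t) (pair-linear a F q H) (eval-linear p F q H))
        (solve 6 (λ a b u q s t → (a :+ q :* b) :+ u :* (s :+ q :* t)
                                := (a :+ u :* s) :+ q :* (b :+ u :* t)) refl
          ⟨ a , F ⟩ ⟨ a , H ⟩ u q (evalPairing p F) (evalPairing p H))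

      -- The functional of `a` is linear and so commutes with the Horner sum; this is where the
      -- variable commutes with the coefficients.
      eval-map-* : ∀ a q F → evalPairing (map (a R.*_) q) F
                           ≡ ⟨ a , (λ g → evalPairing q (λ h → F (g G.∙ h))) ⟩
      eval-map-* a []      F = sym (pair-0 a)
      eval-map-* a (b ∷ q) F = trans
        (cong₂ (λ s t → s ℚ.+ u ℚ.* t) (*-pair a b F) (eval-map-* a q F))
        (sym (pair-linear a _ u _))

      eval-* : ∀ p q F → evalPairing (p *ₚ q) F
                       ≡ evalPairing p (λ g → evalPairing q (λ h → F (g G.∙ h)))
      eval-* []      q F = refl
      eval-* (a ∷ p) q F = trans (eval-+ (map (a R.*_) q) _ F)
        (cong₂ ℚ._+_ (eval-map-* a q F)
          (trans (cong₂ (λ s t → s ℚ.+ u ℚ.* t) (0-pair F) (eval-* p q F)) (ℚ.+-identityˡ _)))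

      -- Being again a pairing, the construction can be iterated: two uses evaluate polynomials in x
      -- and y over the group algebra.
      polynomialPairing : Pairing polynomials
      polynomialPairing = record
        { ⟨_,_⟩       = evalPairing
        ; 0-pair      = λ _ → refl
        ; 1-pair      = λ F → trans (cong₂ ℚ._+_ (1-pair F) (ℚ.*-zeroʳ u)) (ℚ.+-identityʳ _)
        ; +-pair      = eval-+
        ; *-pair      = eval-*
        ; neg-pair    = eval-neg
        ; pair-cong   = eval-cong
        ; pair-0      = eval-0
        ; pair-linear = eval-linear
        }

      eval-constant : ∀ a F → evalPairing (constant a) F ≡ ⟨ a , F ⟩
      eval-constant a F = trans (cong (⟨ a , F ⟩ ℚ.+_) (ℚ.*-zeroʳ u)) (ℚ.+-identityʳ _)

      eval-variable : ∀ F → evalPairing variable-t F ≡ u ℚ.* F G.ε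
      eval-variable F = trans (cong₂ ℚ._+_ (0-pair F) (cong (u ℚ.*_) (eval-constant R.1# F)))
        (trans (ℚ.+-identityˡ _) (cong (u ℚ.*_) (1-pair F)))

    module _ (_≟_ : Decidable G._≈_) where
      private
        A = List (ℚ × G.Carrier)

      pair : A → (G.Carrier → ℚ) → ℚ
      pair a F = foldr (λ (q , g) r → q ℚ.* F g ℚ.+ r) 0ℚ a

      pair-++ : ∀ a b F → pair (a ++ b) F ≡ pair a F ℚ.+ pair b F
      pair-++ []            b F = sym (ℚ.+-identityˡ _)
      pair-++ ((q , g) ∷ a) b F =
        trans (cong (q ℚ.* F g ℚ.+_) (pair-++ a b F)) (sym (ℚ.+-assoc (q ℚ.* F g) (pair a F) (pair b F)))

      pair-scale : ∀ q g b F → pair (map (λ (r , h) → q ℚ.* r , g G.∙ h) b) F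
                             ≡ q ℚ.* pair b (λ h → F (g G.∙ h))
      pair-scale q g []            F = sym (ℚ.*-zeroʳ q)
      pair-scale q g ((r , h) ∷ b) F = trans (cong (q ℚ.* r ℚ.* F (g G.∙ h) ℚ.+_) (pair-scale q g b F))
        (solve 4 (λ q r f s → q :* r :* f :+ q :* s := q :* (r :* f :+ s)) refl
          q r (F (g G.∙ h)) (pair b (λ h → F (g G.∙ h))))

      groupAlgebraPairing : Pairing (groupAlgebra G _≟_)
      groupAlgebraPairing = record
        { ⟨_,_⟩       = pair
        ; 0-pair      = λ _ → refl
        ; 1-pair      = λ F → trans (ℚ.+-identityʳ _) (ℚ.*-identityˡ _)
        ; +-pair      = pair-++
        ; *-pair      = pair-*
        ; neg-pair    = pair-neg
        ; pair-cong   = pair-cong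
        ; pair-0      = pair-0
        ; pair-linear = pair-linear
        }
        where
        pair-* : ∀ a b F → pair (RawRing._*_ (groupAlgebra G _≟_) a b) F
                         ≡ pair a (λ g → pair b (λ h → F (g G.∙ h)))
        pair-* []            b F = refl
        pair-* ((q , g) ∷ a) b F = trans
          (pair-++ (map (λ (r , h) → q ℚ.* r , g G.∙ h) b) _ F)
          (cong₂ ℚ._+_ (pair-scale q g b F) (pair-* a b F))

        pair-neg : ∀ a F → pair (map (λ (q , g) → ℚ.- q , g) a) F ≡ ℚ.- pair a F
        pair-neg []            F = refl
        pair-neg ((q , g) ∷ a) F = trans (cong ((ℚ.- q) ℚ.* F g ℚ.+_) (pair-neg a F))
          (solve 3 (λ q f s → (:- q) :* f :+ (:- s) := :- (q :* f :+ s)) refl q (F g) (pair a F))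

        pair-cong : ∀ a {F H} → (∀ g → F g ≡ H g) → pair a F ≡ pair a H
        pair-cong []            F≗H = refl
        pair-cong ((q , g) ∷ a) F≗H = cong₂ (λ s t → q ℚ.* s ℚ.+ t) (F≗H g) (pair-cong a F≗H)

        pair-0 : ∀ a → pair a (λ _ → 0ℚ) ≡ 0ℚ
        pair-0 []            = refl
        pair-0 ((q , g) ∷ a) = cong₂ ℚ._+_ (ℚ.*-zeroʳ q) (pair-0 a)

        pair-linear : ∀ a F q H → pair a (λ g → F g ℚ.+ q ℚ.* H g) ≡ pair a F ℚ.+ q ℚ.* pair a H
        pair-linear []            F q H = sym (trans (ℚ.+-identityˡ _) (ℚ.*-zeroʳ q))
        pair-linear ((r , g) ∷ a) F q H = trans (cong (r ℚ.* (F g ℚ.+ q ℚ.* H g) ℚ.+_) (pair-linear a F q H))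
          (solve 6 (λ r f h q s t → r :* (f :+ q :* h) :+ (s :+ q :* t)
                                  := (r :* f :+ s) :+ q :* (r :* h :+ t)) refl
            r (F g) (H g) q (pair a F) (pair a H))

      -- Keeping only the terms at `g` amounts to weighting all terms by an indicator. Equality in
      -- the group algebra thereby becomes equality of pairings.
      coefficientAt-pair : ∀ a g → coefficientAt G _≟_ a g
                                 ≡ pair a (λ h → if does (h ≟ g) then 1ℚ else 0ℚ)
      coefficientAt-pair []            g = refl
      coefficientAt-pair ((q , h) ∷ a) g with does (h ≟ g)
      ... | true  = cong₂ ℚ._+_ (sym (ℚ.*-identityʳ q)) (coefficientAt-pair a g)
      ... | false = trans (coefficientAt-pair a g)
        (sym (trans (cong (ℚ._+ _) (ℚ.*-zeroʳ q)) (ℚ.+-identityˡ _)))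

-- Polynomials over ℚ

module RationalPolynomials where
  open Pairings
  open ℚSolver.+-*-Solver using (solve; _:+_; _:*_; _:-_; :-_; _:=_; con)
  open ≡-Reasoning

  ι : ℕ → ℚ
  ι k = ℤ.+ k ℚ./ 1

  -- `_/_` reduces fractions by a gcd, so the laws for `ι` are checked on the unnormalised fractions
  -- k / 1.
  ι-ᵘ : ∀ k → toℚᵘ (ι k) ℚᵘ.≃ ℚᵘ.mkℚᵘ (ℤ.+ k) 0
  ι-ᵘ k = ℚ.toℚᵘ-fromℚᵘ (ℚᵘ.mkℚᵘ (ℤ.+ k) 0)

  ι-injective : Injective _≡_ _≡_ ι
  ι-injective {j} {k} eq with ℚ./-injective-≃ (ℚᵘ.mkℚᵘ (ℤ.+ j) 0) (ℚᵘ.mkℚᵘ (ℤ.+ k) 0) eq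
  ... | ℚᵘ.*≡* e = ℤ.+-injective (trans (sym (ℤ.*-identityʳ (ℤ.+ j))) (trans e (ℤ.*-identityʳ (ℤ.+ k))))

  ι-suc≢0 : ∀ k → ι (suc k) ≢ 0ℚ
  ι-suc≢0 k eq with () ← ι-injective {suc k} {0} eq

  ι-+ : ∀ j k → ι (j ℕ.+ k) ≡ ι j ℚ.+ ι k
  ι-+ j k = ℚ.toℚᵘ-injective (ℚᵘ.≃-trans (ι-ᵘ (j ℕ.+ k)) (ℚᵘ.≃-sym
    (ℚᵘ.≃-trans (ℚ.toℚᵘ-homo-+ (ι j) (ι k)) (ℚᵘ.≃-trans (ℚᵘ.+-cong (ι-ᵘ j) (ι-ᵘ k))
      (ℚᵘ.*≡* (cong (ℤ._* ℤ.+ 1) (cong₂ ℤ._+_ (ℤ.*-identityʳ (ℤ.+ j)) (ℤ.*-identityʳ (ℤ.+ k)))))))))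

  ι-* : ∀ j k → ι (j ℕ.* k) ≡ ι j ℚ.* ι k
  ι-* j k = ℚ.toℚᵘ-injective (ℚᵘ.≃-trans (ι-ᵘ (j ℕ.* k)) (ℚᵘ.≃-sym
    (ℚᵘ.≃-trans (ℚ.toℚᵘ-homo-* (ι j) (ι k)) (ℚᵘ.≃-trans (ℚᵘ.*-cong (ι-ᵘ j) (ι-ᵘ k))
      (ℚᵘ.*≡* (cong (ℤ._* ℤ.+ 1) (sym (ℤ.pos-* j k))))))))

  -- Falling factorials and binomial coefficients

  falling : ℚ → ℕ → ℚ
  falling s zero    = 1ℚ
  falling s (suc k) = s ℚ.* falling (s ℚ.- 1ℚ) k

  -- The definition peels off the first factor; the Pascal recursion in `falling-C` also needs the
  -- last one.
  falling-snoc : ∀ s k → falling s (suc k) ≡ falling s k ℚ.* (s ℚ.- ι k)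
  falling-snoc s zero    = solve 1 (λ s → s :* con 1ℚ := con 1ℚ :* (s :- con 0ℚ)) refl s
  falling-snoc s (suc k) = begin
    s ℚ.* falling (s ℚ.- 1ℚ) (suc k)
      ≡⟨ cong (s ℚ.*_) (falling-snoc (s ℚ.- 1ℚ) k) ⟩
    s ℚ.* (falling (s ℚ.- 1ℚ) k ℚ.* (s ℚ.- 1ℚ ℚ.- ι k))
      ≡⟨ solve 3 (λ s f i → s :* (f :* (s :- con 1ℚ :- i)) := s :* f :* (s :- (con 1ℚ :+ i))) refl
           s (falling (s ℚ.- 1ℚ) k) (ι k) ⟩
    s ℚ.* falling (s ℚ.- 1ℚ) k ℚ.* (s ℚ.- (1ℚ ℚ.+ ι k))
      ≡⟨ cong (λ i → s ℚ.* falling (s ℚ.- 1ℚ) k ℚ.* (s ℚ.- i)) (sym (ι-+ 1 k)) ⟩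
    s ℚ.* falling (s ℚ.- 1ℚ) k ℚ.* (s ℚ.- ι (suc k)) ∎

  ι-suc∸1 : ∀ m → ι (suc m) ℚ.- 1ℚ ≡ ι m
  ι-suc∸1 m = trans (cong (ℚ._- 1ℚ) (ι-+ 1 m))
    (solve 1 (λ i → con 1ℚ :+ i :- con 1ℚ := i) refl (ι m))

  falling-C : ∀ m k → falling (ι m) k ≡ ι (k !) ℚ.* ι (m C k)
  falling-C m       zero    = refl
  falling-C zero    (suc k) = trans (ℚ.*-zeroˡ (falling (0ℚ ℚ.- 1ℚ) k)) (sym (ℚ.*-zeroʳ (ι (suc k !))))
  falling-C (suc m) (suc k) = begin
    ι (suc m) ℚ.* falling (ι (suc m) ℚ.- 1ℚ) k
      ≡⟨ cong₂ (λ s t → s ℚ.* falling t k) (ι-+ 1 m) (ι-suc∸1 m) ⟩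
    (1ℚ ℚ.+ ι m) ℚ.* falling (ι m) k
      -- Splitting m + 1 as (k + 1) + (m - k) produces the two terms of Pascal's rule; the second is
      -- a falling factorial with one more factor.
      ≡⟨ solve 3 (λ m f k → (con 1ℚ :+ m) :* f := (con 1ℚ :+ k) :* f :+ f :* (m :- k)) refl
           (ι m) (falling (ι m) k) (ι k) ⟩
    (1ℚ ℚ.+ ι k) ℚ.* falling (ι m) k ℚ.+ falling (ι m) k ℚ.* (ι m ℚ.- ι k)
      ≡⟨ cong₂ ℚ._+_ (cong ((1ℚ ℚ.+ ι k) ℚ.*_) (falling-C m k))
           (trans (sym (falling-snoc (ι m) k)) (falling-C m (suc k))) ⟩
    (1ℚ ℚ.+ ι k) ℚ.* (ι (k !) ℚ.* ι (m C k)) ℚ.+ ι (suc k !) ℚ.* ι (m C suc k)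
      ≡⟨ cong (λ z → (1ℚ ℚ.+ ι k) ℚ.* (ι (k !) ℚ.* ι (m C k)) ℚ.+ z ℚ.* ι (m C suc k)) fact ⟩
    (1ℚ ℚ.+ ι k) ℚ.* (ι (k !) ℚ.* ι (m C k)) ℚ.+ (1ℚ ℚ.+ ι k) ℚ.* ι (k !) ℚ.* ι (m C suc k)
      ≡⟨ solve 4 (λ k f c d → k :* (f :* c) :+ k :* f :* d := k :* f :* (c :+ d)) refl
           (1ℚ ℚ.+ ι k) (ι (k !)) (ι (m C k)) (ι (m C suc k)) ⟩
    (1ℚ ℚ.+ ι k) ℚ.* ι (k !) ℚ.* (ι (m C k) ℚ.+ ι (m C suc k))
      ≡⟨ cong₂ ℚ._*_ (sym fact) (sym (ι-+ (m C k) (m C suc k))) ⟩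
    ι (suc k !) ℚ.* ι (m C k ℕ.+ m C suc k)
      ≡⟨ cong (λ c → ι (suc k !) ℚ.* ι c) (nCk+nC[k+1]≡[n+1]C[k+1] m k) ⟩
    ι (suc k !) ℚ.* ι (suc m C suc k) ∎
    where
    fact : ι (suc k !) ≡ (1ℚ ℚ.+ ι k) ℚ.* ι (k !)
    fact = trans (ι-* (suc k) (k !)) (cong (ℚ._* ι (k !)) (ι-+ 1 k))

  -- Rational polynomials with infinitely many zeros

  module ℚ[t] = Polynomial ℚ.+-*-rawRing

  evaluate : List ℚ → ℚ → ℚ
  evaluate []      t = 0ℚ
  evaluate (a ∷ p) t = a ℚ.+ t ℚ.* evaluate p t

  nonzero-cancel : ∀ {s t : ℚ} → s ≢ 0ℚ → s ℚ.* t ≡ 0ℚ → t ≡ 0ℚ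
  nonzero-cancel {s} {t} s≢0 st≡0 = begin
    t                         ≡⟨ sym (ℚ.*-identityˡ t) ⟩
    1ℚ ℚ.* t                  ≡⟨ cong (ℚ._* t) (sym (ℚ.*-inverseˡ s)) ⟩
    ℚ.1/ s ℚ.* s ℚ.* t        ≡⟨ ℚ.*-assoc (ℚ.1/ s) s t ⟩
    ℚ.1/ s ℚ.* (s ℚ.* t)      ≡⟨ cong (ℚ.1/ s ℚ.*_) st≡0 ⟩
    ℚ.1/ s ℚ.* 0ℚ             ≡⟨ ℚ.*-zeroʳ (ℚ.1/ s) ⟩
    0ℚ                        ∎
    where instance nz = ℚ.≢-nonZero s≢0

  -- (t p(t) - r p(r)) / (t - r), by Horner's scheme
  quotient : ℚ → List ℚ → List ℚ
  quotient r []      = []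
  quotient r (a ∷ p) = evaluate (a ∷ p) r ∷ quotient r p

  length-quotient : ∀ r p → length (quotient r p) ≡ length p
  length-quotient r []      = refl
  length-quotient r (a ∷ p) = cong suc (length-quotient r p)

  evaluate-quotient : ∀ r a p t → evaluate (a ∷ p) t ≡
    evaluate (a ∷ p) r ℚ.+ (t ℚ.- r) ℚ.* evaluate (quotient r p) t
  evaluate-quotient r a []      t =
    solve 3 (λ r a t → a :+ t :* con 0ℚ := a :+ r :* con 0ℚ :+ (t :- r) :* con 0ℚ) refl r a t
  evaluate-quotient r a (b ∷ p) t = begin
    a ℚ.+ t ℚ.* evaluate (b ∷ p) t
      ≡⟨ cong (λ s → a ℚ.+ t ℚ.* s) (evaluate-quotient r b p t) ⟩
    a ℚ.+ t ℚ.* (evaluate (b ∷ p) r ℚ.+ (t ℚ.- r) ℚ.* evaluate (quotient r p) t)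
      ≡⟨ solve 5 (λ r a t e q → a :+ t :* (e :+ (t :- r) :* q)
           := a :+ r :* e :+ (t :- r) :* (e :+ t :* q)) refl
           r a t (evaluate (b ∷ p) r) (evaluate (quotient r p) t) ⟩
    a ℚ.+ r ℚ.* evaluate (b ∷ p) r ℚ.+
      (t ℚ.- r) ℚ.* (evaluate (b ∷ p) r ℚ.+ t ℚ.* evaluate (quotient r p) t) ∎

  -- Division by t - u(0) leaves a quotient with one coefficient fewer, which vanishes at the
  -- remaining points because `u` never repeats a value. The recursion is on the length, since the
  -- quotient is no sublist of `p`.
  vanishes : ∀ {m} p → length p ≡ m → (u : ℕ → ℚ) → Injective _≡_ _≡_ u →
             (∀ i → evaluate p (u i) ≡ 0ℚ) → ∀ t → evaluate p t ≡ 0ℚ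
  vanishes             []      _   u u-inj p[u]≡0 t = refl
  vanishes {m = suc m} (a ∷ p) len u u-inj p[u]≡0 t = begin
    evaluate (a ∷ p) t                                    ≡⟨ evaluate-quotient r a p t ⟩
    evaluate (a ∷ p) r ℚ.+ (t ℚ.- r) ℚ.* evaluate q t
      ≡⟨ cong₂ (λ x y → x ℚ.+ (t ℚ.- r) ℚ.* y) (p[u]≡0 0) (q≡0 t) ⟩
    0ℚ ℚ.+ (t ℚ.- r) ℚ.* 0ℚ                               ≡⟨ ℚ.+-identityˡ _ ⟩
    (t ℚ.- r) ℚ.* 0ℚ                                      ≡⟨ ℚ.*-zeroʳ (t ℚ.- r) ⟩
    0ℚ                                                    ∎
    where
    r = u 0
    q = quotient r p

    u-suc≢r : ∀ i → u (suc i) ℚ.- r ≢ 0ℚ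
    u-suc≢r i eq with () ← u-inj (x∙y⁻¹≈ε⇒x≈y ℚ.+-0-group (u (suc i)) r eq)

    q[u]≡0 : ∀ i → evaluate q (u (suc i)) ≡ 0ℚ
    q[u]≡0 i = nonzero-cancel (u-suc≢r i) (begin
      (u (suc i) ℚ.- r) ℚ.* evaluate q (u (suc i))          ≡⟨ sym (ℚ.+-identityˡ _) ⟩
      0ℚ ℚ.+ (u (suc i) ℚ.- r) ℚ.* evaluate q (u (suc i))
        ≡⟨ cong (ℚ._+ (u (suc i) ℚ.- r) ℚ.* evaluate q (u (suc i))) (sym (p[u]≡0 0)) ⟩
      evaluate (a ∷ p) r ℚ.+ (u (suc i) ℚ.- r) ℚ.* evaluate q (u (suc i))
        ≡⟨ sym (evaluate-quotient r a p (u (suc i))) ⟩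
      evaluate (a ∷ p) (u (suc i))                          ≡⟨ p[u]≡0 (suc i) ⟩
      0ℚ                                                    ∎)

    q≡0 : ∀ t → evaluate q t ≡ 0ℚ
    q≡0 = vanishes q (trans (length-quotient r p) (ℕ.suc-injective len))
            (u ∘ suc) (ℕ.suc-injective ∘ u-inj) q[u]≡0

  -- The constant coefficient is the value at 0. Once it is 0, the polynomial is t times its tail,
  -- so the tail vanishes at 1, 2, 3, ... and therefore everywhere.
  vanishes⇒coefficient≡0 : ∀ p → (∀ t → evaluate p t ≡ 0ℚ) → ∀ k → ℚ[t].coefficient p k ≡ 0ℚ
  vanishes⇒coefficient≡0 []      p≡0 k       = refl
  vanishes⇒coefficient≡0 (a ∷ p) p≡0 zero    = trans
    (trans (sym (ℚ.+-identityʳ a)) (cong (a ℚ.+_) (sym (ℚ.*-zeroˡ (evaluate p 0ℚ))))) (p≡0 0ℚ)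
  vanishes⇒coefficient≡0 (a ∷ p) p≡0 (suc k) = vanishes⇒coefficient≡0 p
    (vanishes p refl (ι ∘ suc) (ℕ.suc-injective ∘ ι-injective)
      λ i → nonzero-cancel (ι-suc≢0 i)
        (trans (sym (ℚ.+-identityˡ _))
          (trans (cong (ℚ._+ _) (sym (vanishes⇒coefficient≡0 (a ∷ p) p≡0 zero))) (p≡0 (ι (suc i))))))
    k

  infixl 6 _⊖_

  _⊖_ : List ℚ → List ℚ → List ℚ
  []      ⊖ q       = map ℚ.-_ q
  (a ∷ p) ⊖ []      = a ∷ p
  (a ∷ p) ⊖ (b ∷ q) = a ℚ.- b ∷ p ⊖ q

  evaluate-⊖ : ∀ p q t → evaluate (p ⊖ q) t ≡ evaluate p t ℚ.- evaluate q t
  evaluate-⊖ []      []      t = refl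
  evaluate-⊖ []      (b ∷ q) t = trans (cong (λ s → ℚ.- b ℚ.+ t ℚ.* s) (evaluate-⊖ [] q t))
    (solve 3 (λ b t e → (:- b) :+ t :* (con 0ℚ :- e) := con 0ℚ :- (b :+ t :* e)) refl
      b t (evaluate q t))
  evaluate-⊖ (a ∷ p) []      t = sym (ℚ.+-identityʳ _)
  evaluate-⊖ (a ∷ p) (b ∷ q) t = trans (cong (λ s → a ℚ.- b ℚ.+ t ℚ.* s) (evaluate-⊖ p q t))
    (solve 5 (λ a b t d e → a :- b :+ t :* (d :- e) := (a :+ t :* d) :- (b :+ t :* e)) refl
      a b t (evaluate p t) (evaluate q t))

  coefficient-⊖ : ∀ p q k →
    ℚ[t].coefficient (p ⊖ q) k ≡ ℚ[t].coefficient p k ℚ.- ℚ[t].coefficient q k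
  coefficient-⊖ []      []      k       = refl
  coefficient-⊖ []      (b ∷ q) zero    = sym (ℚ.+-identityˡ _)
  coefficient-⊖ []      (b ∷ q) (suc k) = coefficient-⊖ [] q k
  coefficient-⊖ (a ∷ p) []      zero    = sym (ℚ.+-identityʳ _)
  coefficient-⊖ (a ∷ p) []      (suc k) = sym (ℚ.+-identityʳ _)
  coefficient-⊖ (a ∷ p) (b ∷ q) zero    = refl
  coefficient-⊖ (a ∷ p) (b ∷ q) (suc k) = coefficient-⊖ p q k

  evaluate-determines : ∀ p q (u : ℕ → ℚ) → Injective _≡_ _≡_ u →
    (∀ i → evaluate p (u i) ≡ evaluate q (u i)) →
    ∀ k → ℚ[t].coefficient p k ≡ ℚ[t].coefficient q k
  evaluate-determines p q u u-inj eq k = x∙y⁻¹≈ε⇒x≈y ℚ.+-0-group _ _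
    (trans (sym (coefficient-⊖ p q k)) (vanishes⇒coefficient≡0 (p ⊖ q)
      (vanishes (p ⊖ q) refl u u-inj λ i → trans (evaluate-⊖ p q (u i))
        (trans (cong (ℚ._- evaluate q (u i)) (eq i)) (ℚ.+-inverseʳ (evaluate q (u i))))) k))

  module _ {c ℓ r ℓ′} {G : Group c ℓ} {R : RawRing r ℓ′} (P : Pairing G R) where
    private module G = Group G
    open Pairing P
    open Polynomial R

    private
      pairings : List (RawRing.Carrier R) → (G.Carrier → ℚ) → List ℚ
      pairings p F = map (λ a → ⟨ a , F ⟩) p

      evaluate-pairings : ∀ u p F → evaluate (pairings p F) u ≡ evalPairing G P u p F
      evaluate-pairings u []      F = refl
      evaluate-pairings u (a ∷ p) F = cong (λ s → ⟨ a , F ⟩ ℚ.+ u ℚ.* s) (evaluate-pairings u p F)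

      coefficient-pairings : ∀ p F k → ℚ[t].coefficient (pairings p F) k ≡ ⟨ coefficient p k , F ⟩
      coefficient-pairings []      F k       = sym (0-pair F)
      coefficient-pairings (a ∷ p) F zero    = refl
      coefficient-pairings (a ∷ p) F (suc k) = coefficient-pairings p F k

    -- Pairing every coefficient with the fixed `F` yields rational polynomials, to which
    -- interpolation applies.
    evalPairing-determines : ∀ p q F (u : ℕ → ℚ) → Injective _≡_ _≡_ u →
      (∀ i → evalPairing G P (u i) p F ≡ evalPairing G P (u i) q F) →
      ∀ k → ⟨ coefficient p k , F ⟩ ≡ ⟨ coefficient q k , F ⟩
    evalPairing-determines p q F u u-inj eq k = trans (sym (coefficient-pairings p F k))
      (trans
        (evaluate-determines (pairings p F) (pairings q F) u u-inj
          (λ i → trans (evaluate-pairings (u i) p F)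
                       (trans (eq i) (sym (evaluate-pairings (u i) q F)))) k)
        (coefficient-pairings q F k))

-- Sorting and counting

module Counting where
  open import Data.Nat.Base using (_+_; _*_)

  private variable
    A B : Set
    k l n : ℕ

  -- Indicators and finite sums

  𝟙 : {P : Set} → Dec P → ℕ
  𝟙 d = if does d then 1 else 0

  𝟙-yes : {P : Set} (d : Dec P) → P → 𝟙 d ≡ 1
  𝟙-yes (yes _) _ = refl
  𝟙-yes (no ¬p) p = contradiction p ¬p

  𝟙-no : {P : Set} (d : Dec P) → ¬ P → 𝟙 d ≡ 0
  𝟙-no (yes p) ¬p = contradiction p ¬p
  𝟙-no (no _)  _  = refl

  𝟙-⇔ : {P Q : Set} (d : Dec P) (e : Dec Q) → (P → Q) → (Q → P) → 𝟙 d ≡ 𝟙 e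
  𝟙-⇔ (yes p) e P⇒Q Q⇒P = sym (𝟙-yes e (P⇒Q p))
  𝟙-⇔ (no ¬p) e P⇒Q Q⇒P = sym (𝟙-no e (¬p ∘ Q⇒P))

  𝟙-× : {P Q : Set} (d : Dec P) (e : Dec Q) → 𝟙 (d ×-dec e) ≡ 𝟙 d * 𝟙 e
  𝟙-× (yes _) (yes _) = refl
  𝟙-× (yes _) (no _)  = refl
  𝟙-× (no _)  _       = refl

  𝟙-*-cong : {P : Set} (d : Dec P) {i j : ℕ} → (P → i ≡ j) → 𝟙 d * i ≡ 𝟙 d * j
  𝟙-*-cong (yes p) i≡j = cong (_+ 0) (i≡j p)
  𝟙-*-cong (no _)  i≡j = refl

  ∑ : List A → (A → ℕ) → ℕ
  ∑ []       f = 0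
  ∑ (x ∷ xs) f = f x + ∑ xs f

  ∑-cong : (xs : List A) {f g : A → ℕ} → (∀ x → f x ≡ g x) → ∑ xs f ≡ ∑ xs g
  ∑-cong []       f≗g = refl
  ∑-cong (x ∷ xs) f≗g = cong₂ _+_ (f≗g x) (∑-cong xs f≗g)

  ∑-mono : (xs : List A) {f g : A → ℕ} → (∀ x → f x ≤ g x) → ∑ xs f ≤ ∑ xs g
  ∑-mono []       f≤g = z≤n
  ∑-mono (x ∷ xs) f≤g = ℕ.+-mono-≤ (f≤g x) (∑-mono xs f≤g)

  ∑-0 : (xs : List A) → ∑ xs (λ _ → 0) ≡ 0
  ∑-0 []       = refl
  ∑-0 (x ∷ xs) = ∑-0 xs

  ∑-1 : (xs : List A) → ∑ xs (λ _ → 1) ≡ length xs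
  ∑-1 []       = refl
  ∑-1 (x ∷ xs) = cong suc (∑-1 xs)

  ∑-+ : (xs : List A) (f g : A → ℕ) → ∑ xs (λ x → f x + g x) ≡ ∑ xs f + ∑ xs g
  ∑-+ []       f g = refl
  ∑-+ (x ∷ xs) f g = trans (cong (f x + g x +_) (∑-+ xs f g))
    (solve 4 (λ a b c d → a :+ b :+ (c :+ d) := a :+ c :+ (b :+ d)) refl
      (f x) (g x) (∑ xs f) (∑ xs g))
    where open ℕSolver.+-*-Solver

  ∑-*ˡ : (c : ℕ) (xs : List A) (f : A → ℕ) → ∑ xs (λ x → c * f x) ≡ c * ∑ xs f
  ∑-*ˡ c []       f = sym (ℕ.*-zeroʳ c)
  ∑-*ˡ c (x ∷ xs) f = trans (cong (c * f x +_) (∑-*ˡ c xs f)) (sym (ℕ.*-distribˡ-+ c (f x) _))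

  ∑-*ʳ : (c : ℕ) (xs : List A) (f : A → ℕ) → ∑ xs (λ x → f x * c) ≡ ∑ xs f * c
  ∑-*ʳ c xs f = trans (∑-cong xs λ x → ℕ.*-comm (f x) c) (trans (∑-*ˡ c xs f) (ℕ.*-comm c _))

  ∑-swap : (xs : List A) (ys : List B) (f : A → B → ℕ) →
           ∑ xs (λ x → ∑ ys (f x)) ≡ ∑ ys (λ y → ∑ xs (λ x → f x y))
  ∑-swap []       ys f = sym (∑-0 ys)
  ∑-swap (x ∷ xs) ys f = trans (cong (∑ ys (f x) +_) (∑-swap xs ys f)) (sym (∑-+ ys (f x) _))

  ∑-++ : (xs ys : List A) (f : A → ℕ) → ∑ (xs ++ ys) f ≡ ∑ xs f + ∑ ys f
  ∑-++ []       ys f = refl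
  ∑-++ (x ∷ xs) ys f = trans (cong (f x +_) (∑-++ xs ys f)) (sym (ℕ.+-assoc (f x) _ _))

  ∑-map : (h : A → B) (xs : List A) (f : B → ℕ) → ∑ (map h xs) f ≡ ∑ xs (f ∘ h)
  ∑-map h []       f = refl
  ∑-map h (x ∷ xs) f = cong (f (h x) +_) (∑-map h xs f)

  ∑-vectors : (xs : List A) (n : ℕ) (f : Vec A (suc n) → ℕ) →
              ∑ (vectors xs (suc n)) f ≡ ∑ xs (λ x → ∑ (vectors xs n) (f ∘ (x ∷_)))
  ∑-vectors xs n f = go xs
    where
    go : ∀ zs → ∑ (cartesianProductWith _∷_ zs (vectors xs n)) f
              ≡ ∑ zs (λ x → ∑ (vectors xs n) (f ∘ (x ∷_)))
    go []       = refl
    go (z ∷ zs) = trans (∑-++ (map (z ∷_) (vectors xs n)) _ f)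
      (cong₂ _+_ (∑-map (z ∷_) (vectors xs n) f) (go zs))

  length-filter-∑ : {P : A → Set} (P? : Unary.Decidable P) (xs : List A) →
                    length (filter P? xs) ≡ ∑ xs (λ x → 𝟙 (P? x))
  length-filter-∑ P? []       = refl
  length-filter-∑ P? (x ∷ xs) with P? x
  ... | yes _ = cong suc (length-filter-∑ P? xs)
  ... | no _  = length-filter-∑ P? xs

  -- Finite setoids

  record Finite (S : Setoid 0ℓ 0ℓ) : Set where
    open Setoid S using (Carrier; _≈_)
    field
      _≟_        : Decidable _≈_
      list       : List Carrier
      enumerates : Enumerates.IsEnumeration S list
      unique     : UniqueSetoid.Unique S list

  module _ {S : Setoid 0ℓ 0ℓ} (X : Finite S) where
    open Finite X
    private module S = Setoid S

    -- Uniqueness leaves just one entry of `list` equivalent to `z`; it need not be `z` itself,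
    -- hence the congruence condition on `f`.
    ∑-δ : ∀ z (f : S.Carrier → ℕ) → (∀ {y} → y S.≈ z → f y ≡ f z) →
          ∑ list (λ y → 𝟙 (y ≟ z) * f y) ≡ f z
    ∑-δ z f f-cong = go unique (enumerates z)
      where
      absent : ∀ {xs} → All (λ y → ¬ z S.≈ y) xs → ∑ xs (λ y → 𝟙 (y ≟ z) * f y) ≡ 0
      absent []                   = refl
      absent {y ∷ _} (z≉y ∷ z∉ys) =
        cong₂ _+_ (cong (_* f y) (𝟙-no (y ≟ z) (z≉y ∘ S.sym))) (absent z∉ys)

      go : ∀ {xs} → UniqueSetoid.Unique S xs → Any (z S.≈_) xs →
           ∑ xs (λ y → 𝟙 (y ≟ z) * f y) ≡ f z
      go {x ∷ xs} (x∉xs ∷ xs!) (here z≈x) = trans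
        (cong₂ _+_ (trans (cong (_* f x) (𝟙-yes (x ≟ z) (S.sym z≈x))) (ℕ.*-identityˡ (f x)))
                   (absent (All.map (λ x≉y z≈y → x≉y (S.trans (S.sym z≈x) z≈y)) x∉xs)))
        (trans (ℕ.+-identityʳ (f x)) (f-cong (S.sym z≈x)))
      go {x ∷ xs} (x∉xs ∷ xs!) (there z∈xs) = cong₂ _+_
        (cong (_* f x) (𝟙-no (x ≟ z) λ x≈z →
          All.lookupWith (λ x≉y z≈y → x≉y (S.trans x≈z z≈y)) x∉xs z∈xs))
        (go xs! z∈xs)

    ∑-𝟙 : ∀ z → ∑ list (λ y → 𝟙 (y ≟ z)) ≡ 1
    ∑-𝟙 z = trans (∑-cong list λ y → sym (ℕ.*-identityʳ _)) (∑-δ z (λ _ → 1) λ _ → refl)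

  module _ {S T : Setoid 0ℓ 0ℓ} (X : Finite S) (Y : Finite T) where
    private
      module S = Setoid S
      module T = Setoid T
      module X = Finite X
      module Y = Finite Y

    -- Double counting along the graph of `f`, which the two implications identify with the
    -- transposed graph of `g`. Stated through graphs, inverseness already carries the compatibility
    -- with both equivalences.
    ∑-reindex : (f : S.Carrier → T.Carrier) (g : T.Carrier → S.Carrier) →
                (∀ {x y} → y T.≈ f x → x S.≈ g y) → (∀ {x y} → x S.≈ g y → y T.≈ f x) →
                (h : T.Carrier → ℕ) → (∀ {y z} → y T.≈ z → h y ≡ h z) →
                ∑ X.list (h ∘ f) ≡ ∑ Y.list h
    ∑-reindex f g ⇒ ⇐ h h-cong = begin
      ∑ X.list (h ∘ f)
        ≡⟨ ∑-cong X.list (λ x → sym (∑-δ Y (f x) h h-cong)) ⟩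
      ∑ X.list (λ x → ∑ Y.list λ y → 𝟙 (y Y.≟ f x) * h y)
        ≡⟨ ∑-swap X.list Y.list _ ⟩
      ∑ Y.list (λ y → ∑ X.list λ x → 𝟙 (y Y.≟ f x) * h y)
        ≡⟨ ∑-cong Y.list (λ y → ∑-cong X.list λ x →
             cong (_* h y) (𝟙-⇔ (y Y.≟ f x) (x X.≟ g y) ⇒ ⇐)) ⟩
      ∑ Y.list (λ y → ∑ X.list λ x → 𝟙 (x X.≟ g y) * h y)
        ≡⟨ ∑-cong Y.list (λ y → ∑-δ X (g y) (λ _ → h y) λ _ → refl) ⟩
      ∑ Y.list h ∎
      where open ≡-Reasoning

  points-finite : ∀ n → Finite (setoid ±[ n ])
  points-finite n = record
    { _≟_        = _≟±_
    ; list       = points n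
    ; enumerates = points-enumerates
    ; unique     = points-unique
    }

  vectors-finite : ∀ k n → Finite (setoid (Vec ±[ k ] n))
  vectors-finite k n = record
    { _≟_        = Vec.≡-dec _≟±_
    ; list       = vectors (points k) n
    ; enumerates = vectors-enumerates points-enumerates
    ; unique     = vectors-unique points-unique n
    }

  𝔅-finite : ∀ n → Finite (Group.setoid (𝔅-group n))
  𝔅-finite n = record
    { _≟_        = _≟𝔅_
    ; list       = elements n
    ; enumerates = elements-enumerates
    ; unique     = elements-unique
    }

  -- Pigeonhole by counting: the fibres of an injective map have at most one element, and their
  -- sizes add up to the length of the list. A missed `t` has an empty fibre, so adding 1 there
  -- keeps every summand at most 1 while the total exceeds the length.
  finite-injective⇒surjective : {A : Set} → Finite (setoid A) → (f : A → A) →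
    Injective _≡_ _≡_ f → (∃? : ∀ t → Dec (∃ λ s → f s ≡ t)) → ∀ t → ∃ λ s → f s ≡ t
  finite-injective⇒surjective {A} X f f-inj ∃? t with ∃? t
  ... | yes found = found
  ... | no ¬found = contradiction
    (ℕ.≤-trans (ℕ.≤-reflexive (trans (ℕ.+-comm 1 _) (sym count)))
      (ℕ.≤-trans (∑-mono list bound) (ℕ.≤-reflexive (∑-1 list)))) ℕ.1+n≰n
    where
    open Finite X
    open ≡-Reasoning

    fibre : A → ℕ
    fibre t′ = ∑ list (λ s → 𝟙 (f s ≟ t′))

    fibre-image : ∀ s → fibre (f s) ≡ 1
    fibre-image s = trans (∑-cong list λ s′ → 𝟙-⇔ (f s′ ≟ f s) (s′ ≟ s) f-inj (cong f)) (∑-𝟙 X s)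

    fibre-empty : ∀ t′ → ¬ (∃ λ s → f s ≡ t′) → fibre t′ ≡ 0
    fibre-empty t′ ¬ex = trans (∑-cong list λ s → 𝟙-no (f s ≟ t′) (¬ex ∘ (s ,_))) (∑-0 list)

    bound : ∀ t′ → fibre t′ + 𝟙 (t′ ≟ t) ≤ 1
    bound t′ with t′ ≟ t | ∃? t′
    ... | yes refl | _              = ℕ.≤-reflexive (cong (_+ 1) (fibre-empty t ¬found))
    ... | no _     | yes (s , refl) = ℕ.≤-reflexive (trans (ℕ.+-identityʳ _) (fibre-image s))
    ... | no _     | no ¬ex         =
      ℕ.≤-trans (ℕ.≤-reflexive (trans (ℕ.+-identityʳ _) (fibre-empty t′ ¬ex))) z≤n

    count : ∑ list (λ t′ → fibre t′ + 𝟙 (t′ ≟ t)) ≡ length list + 1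
    count = trans (∑-+ list fibre _) (cong₂ _+_
      (trans (∑-swap list list _)
        (trans (∑-cong list λ s → trans (∑-cong list λ t′ →
                                    𝟙-⇔ (f s ≟ t′) (t′ ≟ f s) sym sym) (∑-𝟙 X (f s)))
               (∑-1 list)))
      (∑-𝟙 X t))

  -- Existence and uniqueness of the sorting element

  lexOrder : StrictTotalOrder 0ℓ 0ℓ 0ℓ
  lexOrder = ×-strictTotalOrder ℤ.<-strictTotalOrder ℤ.<-strictTotalOrder

  Lex : (±[ n ] → ℤ) → ±[ n ] → ±[ n ] → Set
  Lex b = StrictTotalOrder._<_ lexOrder on (λ s → b s , value s)

  lex-cmp : (b : ±[ n ] → ℤ) → Trichotomous _≡_ (Lex b)
  lex-cmp b s t with StrictTotalOrder.compare lexOrder (b s , value s) (b t , value t)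
  ... | tri< < ≢ ≯ = tri< < (λ { refl → ≢ (refl , refl) }) ≯
  ... | tri≈ ≮ ≡ ≯ = tri≈ ≮ (value-injective (proj₂ ≡)) ≯
  ... | tri> ≮ ≢ > = tri> ≮ (λ { refl → ≢ (refl , refl) }) >

  lex? : (b : ±[ n ] → ℤ) → Decidable (Lex b)
  lex? b s t = StrictTotalOrder._<?_ lexOrder (b s , value s) (b t , value t)

  lex-trans : (b : ±[ n ] → ℤ) → ∀ {s t u} → Lex b s t → Lex b t u → Lex b s u
  lex-trans b {s} {t} {u} = StrictTotalOrder.trans lexOrder
    {b s , value s} {b t , value t} {b u , value u}

  lex-irrefl : (b : ±[ n ] → ℤ) → ∀ s → ¬ Lex b s s
  lex-irrefl b s = StrictTotalOrder.irrefl lexOrder {b s , value s} (refl , refl)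

  Odd : (±[ n ] → ℤ) → Set
  Odd b = ∀ s → b (neg s) ≡ ℤ.- b s

  lex-neg : {b : ±[ n ] → ℤ} → Odd b → ∀ {s t} → Lex b s t → Lex b (neg t) (neg s)
  lex-neg b-odd {s} {t} (inj₁ bs<bt) =
    inj₁ (subst₂ ℤ._<_ (sym (b-odd t)) (sym (b-odd s)) (ℤ.neg-mono-< bs<bt))
  lex-neg b-odd {s} {t} (inj₂ (bs≡bt , s<t)) =
    inj₂ (trans (b-odd t) (trans (cong ℤ.-_ (sym bs≡bt)) (sym (b-odd s))) , ℤ.neg-mono-< s<t)

  Sorted : (±[ n ] → ℤ) → 𝔅 n → Set
  Sorted b π = ∀ {s t} → value s ℤ.< value t → Lex b (π ⟨$⟩ s) (π ⟨$⟩ t)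

  module _ {n : ℕ} (b : ±[ n ] → ℤ) where
    rank : ±[ n ] → ℕ
    rank s = ∑ (points n) λ t → 𝟙 (lex? b t s)

    -- Whatever lies below `s` lies below `t`, and `s` itself is one more point below `t`.
    rank-mono : ∀ {s t} → Lex b s t → rank s ℕ.< rank t
    rank-mono {s} {t} s≺t = ℕ.≤-trans
      (ℕ.≤-reflexive (trans (ℕ.+-comm 1 (rank s)) (trans
        (cong (rank s +_) (sym (∑-𝟙 (points-finite n) s)))
        (sym (∑-+ (points n) (λ u → 𝟙 (lex? b u s)) (λ u → 𝟙 (u ≟± s)))))))
      (∑-mono (points n) below)
      where
      below : ∀ u → 𝟙 (lex? b u s) + 𝟙 (u ≟± s) ≤ 𝟙 (lex? b u t)
      below u with lex-cmp b u s
      ... | tri< u≺s u≢s _ rewrite 𝟙-yes (lex? b u s) u≺s | 𝟙-no (u ≟± s) u≢s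
                                 | 𝟙-yes (lex? b u t) (lex-trans b {u} {s} {t} u≺s s≺t) = ℕ.≤-refl
      ... | tri≈ u⊀s refl _ rewrite 𝟙-no (lex? b u u) u⊀s | 𝟙-yes (u ≟± u) refl
                                 | 𝟙-yes (lex? b u t) s≺t = ℕ.≤-refl
      ... | tri> u⊀s u≢s _ rewrite 𝟙-no (lex? b u s) u⊀s | 𝟙-no (u ≟± s) u≢s = z≤n

    rank-injective : ∀ {s t} → rank s ≡ rank t → s ≡ t
    rank-injective {s} {t} eq with lex-cmp b s t
    ... | tri< s≺t _ _ = contradiction eq (ℕ.<⇒≢ (rank-mono {s} {t} s≺t))
    ... | tri≈ _ s≡t _ = s≡t
    ... | tri> _ _ t≺s = contradiction (sym eq) (ℕ.<⇒≢ (rank-mono {t} {s} t≺s))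

    -- For sorted σ the rank of σ(s) is the number of points less than s, which does not depend on
    -- σ; and ranks separate points.
    sorted-unique : ∀ {σ τ} → Sorted b σ → Sorted b τ → σ ≈𝔅 τ
    sorted-unique {σ} {τ} σ-sorted τ-sorted s =
      rank-injective (trans (rank-sorted σ σ-sorted) (sym (rank-sorted τ τ-sorted)))
      where
      rank-sorted : ∀ σ → Sorted b σ →
                    rank (σ ⟨$⟩ s) ≡ ∑ (points n) λ u → 𝟙 (value u ℤ.<? value s)
      rank-sorted σ σ-sorted = trans
        (sym (∑-reindex (points-finite n) (points-finite n) (σ ⟨$⟩_) (𝔅.from σ)
          (λ { refl → sym (from∘to _) }) (λ { refl → sym (to∘from _) })
          _ λ { refl → refl }))
        (∑-cong (points n) λ u → 𝟙-⇔ (lex? b (σ ⟨$⟩ u) (σ ⟨$⟩ s)) (value u ℤ.<? value s)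
          (reflects u) σ-sorted)
        where
        open Inverse (bijection σ)
          renaming (strictlyInverseˡ to to∘from; strictlyInverseʳ to from∘to)

        reflects : ∀ u → Lex b (σ ⟨$⟩ u) (σ ⟨$⟩ s) → value u ℤ.< value s
        reflects u σu≺σs with ℤ.<-cmp (value u) (value s)
        ... | tri< u<s _ _ = u<s
        ... | tri≈ _ u≡s _ with refl ← value-injective {s = u} {t = s} u≡s =
          contradiction σu≺σs (lex-irrefl b (σ ⟨$⟩ u))
        ... | tri> _ _ s<u = contradiction
          (lex-trans b {σ ⟨$⟩ u} {σ ⟨$⟩ s} {σ ⟨$⟩ u} σu≺σs (σ-sorted s<u)) (lex-irrefl b (σ ⟨$⟩ u))

    module _ (b-odd : Odd b) where
      -- Negation reverses the order for odd `b`, so `rank (neg s)` counts the points above `s`. The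
      -- points below, the points above and `s` itself make up all 2n + 1.
      rank-neg : ∀ s → rank s + rank (neg s) ≡ n + n
      rank-neg s = ℕ.suc-injective (begin
        suc (rank s + rank (neg s))
          ≡⟨ ℕ.+-comm 1 _ ⟩
        rank s + rank (neg s) + 1
          ≡⟨ cong₂ (λ i j → rank s + i + j) reflected (sym (∑-𝟙 (points-finite n) s)) ⟩
        rank s + ∑ (points n) (λ t → 𝟙 (lex? b s t)) + ∑ (points n) (λ t → 𝟙 (t ≟± s))
          ≡⟨ cong (_+ ∑ (points n) (λ t → 𝟙 (t ≟± s)))
               (sym (∑-+ (points n) (λ t → 𝟙 (lex? b t s)) (λ t → 𝟙 (lex? b s t)))) ⟩
        ∑ (points n) (λ t → 𝟙 (lex? b t s) + 𝟙 (lex? b s t)) + ∑ (points n) (λ t → 𝟙 (t ≟± s))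
          ≡⟨ sym (∑-+ (points n) _ (λ t → 𝟙 (t ≟± s))) ⟩
        ∑ (points n) (λ t → 𝟙 (lex? b t s) + 𝟙 (lex? b s t) + 𝟙 (t ≟± s))
          ≡⟨ ∑-cong (points n) trichotomy ⟩
        ∑ (points n) (λ _ → 1)
          ≡⟨ ∑-1 (points n) ⟩
        length (points n)
          ≡⟨ trans (List.length-++ (map at (allFin (suc n)))) (cong₂ _+_
               (trans (List.length-map at (allFin (suc n))) (List.length-tabulate {n = suc n} id))
               (trans (List.length-map _ (allFin n)) (List.length-tabulate {n = n} id))) ⟩
        suc n + n ∎)
        where
        open ≡-Reasoning

        reflected : rank (neg s) ≡ ∑ (points n) (λ t → 𝟙 (lex? b s t))
        reflected = trans
          (sym (∑-reindex (points-finite n) (points-finite n) neg neg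
            (λ { refl → sym (neg-involutive _) }) (λ { refl → sym (neg-involutive _) })
            (λ t → 𝟙 (lex? b t (neg s))) λ { refl → refl }))
          (∑-cong (points n) λ t → 𝟙-⇔ (lex? b (neg t) (neg s)) (lex? b s t)
            (λ -t≺-s → subst₂ (Lex b) (neg-involutive s) (neg-involutive t)
                         (lex-neg b-odd {neg t} {neg s} -t≺-s))
            (lex-neg b-odd {s} {t}))

        trichotomy : ∀ t → 𝟙 (lex? b t s) + 𝟙 (lex? b s t) + 𝟙 (t ≟± s) ≡ 1
        trichotomy t with lex-cmp b t s
        ... | tri< t≺s t≢s s⊀t rewrite 𝟙-yes (lex? b t s) t≺s | 𝟙-no (lex? b s t) s⊀t
                                     | 𝟙-no (t ≟± s) t≢s = refl
        ... | tri≈ t⊀s t≡s s⊀t rewrite 𝟙-no (lex? b t s) t⊀s | 𝟙-no (lex? b s t) s⊀t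
                                     | 𝟙-yes (t ≟± s) t≡s = refl
        ... | tri> t⊀s t≢s s≺t rewrite 𝟙-no (lex? b t s) t⊀s | 𝟙-yes (lex? b s t) s≺t
                                     | 𝟙-no (t ≟± s) t≢s = refl

      private
        -- The place of `s` in the sorted sequence, with places numbered from -n to n. `rank-neg`
        -- makes it bounded and odd; the sorting element, which sends places to points, is its
        -- inverse.
        centred : ±[ n ] → ±[ n ]
        centred s = mk± (ℤ.+ rank s ℤ.- ℤ.+ n) (subst (λ z → ∣ z ∣ ≤ n)
          (sym (ℤ.m-n≡m⊖n (rank s) n)) bound)
          where
          bound : ∣ rank s ℤ.⊖ n ∣ ≤ n
          bound with ℕ.≤-total (rank s) n
          ... | inj₁ r≤n = subst (_≤ n) (sym (ℤ.∣⊖∣-≤ r≤n)) (ℕ.m∸n≤m n (rank s))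
          ... | inj₂ n≤r = subst (_≤ n)
            (sym (trans (ℤ.∣m⊖n∣≡∣n⊖m∣ (rank s) n) (ℤ.∣⊖∣-≤ n≤r)))
            (ℕ.m≤n+o⇒m∸n≤o (rank s) n (ℕ.≤-trans (ℕ.m≤m+n _ _) (ℕ.≤-reflexive (rank-neg s))))

        centred-odd : ∀ s → centred (neg s) ≡ neg (centred s)
        centred-odd s = value-injective (begin
          ℤ.+ r′ ℤ.- ℤ.+ n
            ≡⟨ solve 3 (λ r r′ n → r′ :- n := (r :+ r′) :- r :- n) refl (ℤ.+ r) (ℤ.+ r′) (ℤ.+ n) ⟩
          (ℤ.+ r ℤ.+ ℤ.+ r′) ℤ.- ℤ.+ r ℤ.- ℤ.+ n
            ≡⟨ cong (λ z → z ℤ.- ℤ.+ r ℤ.- ℤ.+ n) (cong ℤ.+_ (rank-neg s)) ⟩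
          (ℤ.+ n ℤ.+ ℤ.+ n) ℤ.- ℤ.+ r ℤ.- ℤ.+ n
            ≡⟨ solve 2 (λ r n → (n :+ n) :- r :- n := :- (r :- n)) refl (ℤ.+ r) (ℤ.+ n) ⟩
          ℤ.- (ℤ.+ r ℤ.- ℤ.+ n) ∎)
          where
          open ≡-Reasoning
          open ℤSolver.+-*-Solver
          r = rank s
          r′ = rank (neg s)

        centred-injective : Injective _≡_ _≡_ centred
        centred-injective {s} {t} eq = rank-injective
          (ℤ.+-injective (∙-cancelʳ (AbelianGroup.group ℤ.+-0-abelianGroup)
          (ℤ.- ℤ.+ n) (ℤ.+ rank s) (ℤ.+ rank t) (cong value eq)))

        centred-surjective : ∀ t → ∃ λ s → centred s ≡ t
        centred-surjective = finite-injective⇒surjective (points-finite n) centred centred-injective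
          λ t → ∃±? λ s → centred s ≟± t

        -- abstract, since unfolding it makes conversion checking intractable
        abstract
          centring : 𝔅 n
          centring = record
            { bijection = ⤖⇒↔ (mk⤖ (centred-injective , λ t →
                proj₁ (centred-surjective t) , λ { refl → proj₂ (centred-surjective t) }))
            ; odd = centred-odd
            }

          centring-centred : ∀ s → centring ⟨$⟩ s ≡ centred s
          centring-centred s = refl

      sort : 𝔅 n
      sort = Group._⁻¹ (𝔅-group n) centring

      -- Since `centred` strictly increases along `Lex b` and both orders are total, its inverse
      -- increases as well.
      sort-sorted : Sorted b sort
      sort-sorted {s} {t} s<t with lex-cmp b (sort ⟨$⟩ s) (sort ⟨$⟩ t)
      ... | tri< s≺t _ _ = s≺t
      ... | tri≈ _ eq _  = contradiction (cong value s≡t) (ℤ.<⇒≢ s<t)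
        where
        s≡t : s ≡ t
        s≡t = trans (sym (Group.inverseʳ (𝔅-group n) centring s))
                (trans (cong (centring ⟨$⟩_) eq) (Group.inverseʳ (𝔅-group n) centring t))
      ... | tri> _ _ t≺s = contradiction s<t (ℤ.<-asym (subst₂ ℤ._<_ (centred-sort t) (centred-sort s)
        (ℤ.+-monoˡ-< (ℤ.- ℤ.+ n) (ℤ.+<+ (rank-mono {sort ⟨$⟩ t} {sort ⟨$⟩ s} t≺s)))))
        where
        centred-sort : ∀ u → value (centred (sort ⟨$⟩ u)) ≡ value u
        centred-sort u = cong value (trans (sym (centring-centred (sort ⟨$⟩ u)))
                                           (Group.inverseʳ (𝔅-group n) centring u))

  -- Odd extensions and precomposition

  module Extension {A : Set} (ng : A → A) (z : A)
                   (ng-involutive : ∀ a → ng (ng a) ≡ a) (ng-z : ng z ≡ z) where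

    ext : Vec A n → ±[ n ] → A
    ext w (mk± (ℤ.+ zero)  _)   = z
    ext w (mk± (ℤ.+ suc k) k<n) = Vec.lookup w (fromℕ< k<n)
    ext w (mk± -[1+ k ]    k<n) = ng (Vec.lookup w (fromℕ< k<n))

    ext-neg : (w : Vec A n) → ∀ s → ext w (neg s) ≡ ng (ext w s)
    ext-neg w (mk± (ℤ.+ zero)  _) = sym ng-z
    ext-neg w (mk± (ℤ.+ suc k) _) = refl
    ext-neg w (mk± -[1+ k ]    _) = sym (ng-involutive _)

    ext-at : (w : Vec A n) → ∀ i → ext w (at (Fin.suc i)) ≡ Vec.lookup w i
    ext-at w i = cong (Vec.lookup w) (Fin.fromℕ<-toℕ i (Fin.toℕ<n i))

    -- Precomposition with σ of the odd map given by `w`, written on windows; a right action.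
    act : Vec A n → 𝔅 n → Vec A n
    act w σ = Vec.tabulate λ i → ext w (σ ⟨$⟩ at (Fin.suc i))

    ext-act : (w : Vec A n) (σ : 𝔅 n) → ∀ s → ext (act w σ) s ≡ ext w (σ ⟨$⟩ s)
    ext-act w σ (mk± (ℤ.+ zero)  _)   = sym (cong (ext w) (0-fixed σ))
    ext-act w σ (mk± (ℤ.+ suc k) k<n) = trans
      (Vec.lookup∘tabulate _ (fromℕ< k<n))
      (cong (λ s → ext w (σ ⟨$⟩ s)) (value-injective (cong (ℤ.+_ ∘ suc) (Fin.toℕ-fromℕ< k<n))))
    ext-act w σ (mk± -[1+ k ]    k<n) = trans
      (cong ng (Vec.lookup∘tabulate _ (fromℕ< k<n)))
      (trans (sym (ext-neg w (σ ⟨$⟩ at (Fin.suc (fromℕ< k<n))))) (cong (ext w) (trans (sym (odd σ _))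
        (cong (σ ⟨$⟩_) (value-injective (cong -[1+_] (Fin.toℕ-fromℕ< k<n)))))))

    act-act : (w : Vec A n) (σ τ : 𝔅 n) → (∀ s → σ ⟨$⟩ (τ ⟨$⟩ s) ≡ s) → act (act w σ) τ ≡ w
    act-act w σ τ στ≈ε = trans
      (Vec.tabulate-cong λ i → trans (ext-act w σ (τ ⟨$⟩ at (Fin.suc i)))
        (trans (cong (ext w) (στ≈ε (at (Fin.suc i)))) (ext-at w i)))
      (Vec.tabulate∘lookup w)

  -- Both kinds of values are needed: bounded ones because their vectors can be listed, integers
  -- because digit expansions leave the bounds.
  module ℤ-ext = Extension ℤ.-_ (ℤ.+ 0) ℤ.neg-involutive refl
  module ±-ext {k : ℕ} = Extension {±[ k ]} neg (at Fin.zero) neg-involutive refl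

  open ℤ-ext using () renaming (ext to odd-extension)
  open ±-ext using (act)

  value-ext : (v : Vec ±[ k ] n) → ∀ s → value (±-ext.ext v s) ≡ odd-extension (Vec.map value v) s
  value-ext v (mk± (ℤ.+ zero)  _)   = refl
  value-ext v (mk± (ℤ.+ suc k) k<n) = sym (Vec.lookup-map (fromℕ< k<n) value v)
  value-ext v (mk± -[1+ k ]    k<n) = cong ℤ.-_ (sym (Vec.lookup-map (fromℕ< k<n) value v))

  odd-extension-act : (v : Vec ±[ k ] n) (σ : 𝔅 n) → ∀ s →
    odd-extension (Vec.map value (act v σ)) s ≡ odd-extension (Vec.map value v) (σ ⟨$⟩ s)
  odd-extension-act v σ s = trans (sym (value-ext (act v σ) s))
    (trans (cong value (±-ext.ext-act v σ s)) (value-ext v (σ ⟨$⟩ s)))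

  -- Precomposition permutes the odd maps with values in [-k, k], the inverse element undoing it.
  -- This allows maps to be reparametrised by their rearrangements.
  ∑-act : (σ : 𝔅 n) (f : Vec ±[ k ] n → ℕ) →
          ∑ (vectors (points k) n) (λ v → f (act v σ)) ≡ ∑ (vectors (points k) n) f
  ∑-act {n} {k} σ f = ∑-reindex (vectors-finite k n) (vectors-finite k n)
    (λ v → act v σ) (λ v → act v (σ ⁻¹))
    (λ { refl → sym (±-ext.act-act _ σ (σ ⁻¹) (inverseʳ σ)) })
    (λ { refl → sym (±-ext.act-act _ (σ ⁻¹) σ (inverseˡ σ)) })
    f λ { refl → refl }
    where open Group (𝔅-group n) using (_⁻¹; inverseˡ; inverseʳ)

  sortVec : Vec ℤ n → 𝔅 n
  sortVec w = sort (odd-extension w) (ℤ-ext.ext-neg w)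

  sorted⇒≈sortVec : (w : Vec ℤ n) {σ : 𝔅 n} → Sorted (odd-extension w) σ → σ ≈𝔅 sortVec w
  sorted⇒≈sortVec w {σ} σ-sorted =
    sorted-unique (odd-extension w) {σ} {sortVec w} σ-sorted
      (sort-sorted (odd-extension w) (ℤ-ext.ext-neg w))

  sorted-cong : {b c : ±[ n ] → ℤ} {σ τ : 𝔅 n} →
                (∀ s → b s ≡ c s) → σ ≈𝔅 τ → Sorted b σ → Sorted c τ
  sorted-cong {b = b} {c} {σ} {τ} b≗c σ≈τ σ-sorted {s} {t} s<t =
    subst₂ (Lex c) (σ≈τ s) (σ≈τ t) (lex-cong (σ-sorted s<t))
    where
    lex-cong : Lex b (σ ⟨$⟩ s) (σ ⟨$⟩ t) → Lex c (σ ⟨$⟩ s) (σ ⟨$⟩ t)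
    lex-cong (inj₁ b<)       = inj₁ (subst₂ ℤ._<_ (b≗c _) (b≗c _) b<)
    lex-cong (inj₂ (b≡ , <)) = inj₂ (trans (sym (b≗c _)) (trans b≡ (b≗c _)) , <)

  -- Digits in base 2k and products of sorting elements

  digits : ℕ → ℤ → ℤ → ℤ
  digits k a b = ℤ.+ (k + k) ℤ.* a ℤ.+ b

  -- `digits k` is linear in the pair of its integer arguments, so it commutes with odd extension.
  odd-extension-digits : ∀ k (a b : Vec ℤ n) s → odd-extension (Vec.zipWith (digits k) a b) s
                       ≡ digits k (odd-extension a s) (odd-extension b s)
  odd-extension-digits k a b (mk± (ℤ.+ zero)  _)   =
    sym (trans (ℤ.+-identityʳ _) (ℤ.*-zeroʳ (ℤ.+ (k + k))))
  odd-extension-digits k a b (mk± (ℤ.+ suc j) j<n) = Vec.lookup-zipWith (digits k) (fromℕ< j<n) a b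
  odd-extension-digits k a b (mk± -[1+ j ]    j<n) = trans
    (cong ℤ.-_ (Vec.lookup-zipWith (digits k) (fromℕ< j<n) a b))
    (solve 3 (λ k a b → :- (k :* a :+ b) := k :* (:- a) :+ (:- b)) refl
      (ℤ.+ (k + k)) (Vec.lookup a (fromℕ< j<n)) (Vec.lookup b (fromℕ< j<n)))
    where open ℤSolver.+-*-Solver

  -- The last hypothesis is what the range [-k, k-1] on positive points says about the odd
  -- extension: a value -k at a positive point becomes k at its negative, and k occurs nowhere else.
  module _ (k : ℕ) {n : ℕ} (a b : ±[ n ] → ℤ) (b-odd : Odd b)
           (b≤k : ∀ s → b s ℤ.≤ ℤ.+ k) (b≡k⇒<0 : ∀ s → b s ≡ ℤ.+ k → value s ℤ.< ℤ.+ 0) where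
    private
      c : ±[ n ] → ℤ
      c s = digits k (a s) (b s)

      -k≤b : ∀ s → ℤ.- ℤ.+ k ℤ.≤ b s
      -k≤b s = subst (ℤ.- ℤ.+ k ℤ.≤_) (trans (cong ℤ.-_ (b-odd s)) (ℤ.neg-involutive (b s)))
        (ℤ.neg-mono-≤ (b≤k (neg s)))

      b≡-k⇒>0 : ∀ s → b s ≡ ℤ.- ℤ.+ k → ℤ.+ 0 ℤ.< value s
      b≡-k⇒>0 s eq = subst (ℤ.+ 0 ℤ.<_) (ℤ.neg-involutive (value s)) (ℤ.neg-mono-<
        (b≡k⇒<0 (neg s) (trans (b-odd s) (trans (cong ℤ.-_ eq) (ℤ.neg-involutive (ℤ.+ k))))))

      module Bounds (s t : ±[ n ]) where
        N = ℤ.+ (k + k)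

        cs≤high : c s ℤ.≤ digits k (a s) (ℤ.+ k)
        cs≤high = ℤ.+-monoʳ-≤ (N ℤ.* a s) (b≤k s)

        -- Combined values with leading digit a lie in [2ka - k, 2ka + k]. For consecutive leading
        -- digits these intervals share an endpoint, so only a weak inequality is available.
        high≤low : a s ℤ.< a t → digits k (a s) (ℤ.+ k) ℤ.≤ digits k (a t) (ℤ.- ℤ.+ k)
        high≤low a< = subst (ℤ._≤ digits k (a t) (ℤ.- ℤ.+ k))
          (solve 2 (λ k a → (k :+ k) :* (con (ℤ.+ 1) :+ a) :+ (:- k) := (k :+ k) :* a :+ k) refl
            (ℤ.+ k) (a s))
          (ℤ.+-monoˡ-≤ (ℤ.- ℤ.+ k) (ℤ.*-monoˡ-≤-nonNeg N (ℤ.i<j⇒suc[i]≤j a<)))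
          where open ℤSolver.+-*-Solver

        low≤ct : digits k (a t) (ℤ.- ℤ.+ k) ℤ.≤ c t
        low≤ct = ℤ.+-monoʳ-≤ (N ℤ.* a t) (-k≤b t)

        high≤ct : a s ℤ.< a t → digits k (a s) (ℤ.+ k) ℤ.≤ c t
        high≤ct a< = ℤ.≤-trans (high≤low a<) low≤ct

    -- If c s = c t although a s < a t, then b s = k and b t = -k, which forces s < 0 < t.
    lex-digits : ∀ {s t} → a s ℤ.< a t ⊎ (a s ≡ a t × Lex b s t) → Lex c s t
    lex-digits {s} {t} (inj₂ (as≡at , inj₁ bs<bt)) = inj₁ (subst (λ x → c s ℤ.< digits k x (b t))
      as≡at (ℤ.+-monoʳ-< (ℤ.+ (k + k) ℤ.* a s) bs<bt))
    lex-digits {s} {t} (inj₂ (as≡at , inj₂ (bs≡bt , s<t))) =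
      inj₂ (cong₂ (digits k) as≡at bs≡bt , s<t)
    lex-digits {s} {t} (inj₁ a<) with c s ℤ.≟ c t
    ... | no cs≢ct  = inj₁ (ℤ.≤∧≢⇒< (ℤ.≤-trans cs≤high (high≤ct a<)) cs≢ct)
      where open Bounds s t
    ... | yes cs≡ct = inj₂ (cs≡ct , ℤ.<-trans (b≡k⇒<0 s bs≡k) (b≡-k⇒>0 t bt≡-k))
      where
      open Bounds s t

      bs≡k : b s ≡ ℤ.+ k
      bs≡k = ∙-cancelˡ (AbelianGroup.group ℤ.+-0-abelianGroup) (N ℤ.* a s) (b s) (ℤ.+ k) (ℤ.≤-antisym cs≤high
        (ℤ.≤-trans (high≤ct a<) (ℤ.≤-reflexive (sym cs≡ct))))

      bt≡-k : b t ≡ ℤ.- ℤ.+ k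
      bt≡-k = ∙-cancelˡ (AbelianGroup.group ℤ.+-0-abelianGroup) (N ℤ.* a t) (b t) (ℤ.- ℤ.+ k) (ℤ.≤-antisym
        (ℤ.≤-trans (ℤ.≤-reflexive (sym cs≡ct)) (ℤ.≤-trans cs≤high (high≤low a<)))
        low≤ct)

  -- The range [-k, k-1] is cut out of `±[ k ]` by a condition, so that both kinds of sums run over
  -- the same lists. Keeping `M` separate from `k` lets the same condition bound chains.
  Below : ℕ → Vec ±[ k ] n → Set
  Below M v = ∀ i → value (Vec.lookup v i) ℤ.< ℤ.+ M

  below? : ∀ M (v : Vec ±[ k ] n) → Dec (Below M v)
  below? M v = Fin.all? λ i → value (Vec.lookup v i) ℤ.<? ℤ.+ M

  𝟙-below-∷ : ∀ M (z : ±[ k ]) (v : Vec ±[ k ] n) →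
              𝟙 (below? M (z ∷ v)) ≡ 𝟙 (value z ℤ.<? ℤ.+ M) * 𝟙 (below? M v)
  𝟙-below-∷ M z v = trans
    (𝟙-⇔ (below? M (z ∷ v)) ((value z ℤ.<? ℤ.+ M) ×-dec below? M v)
      (λ z∷v< → z∷v< Fin.zero , z∷v< ∘ Fin.suc)
      λ { (z< , v<) Fin.zero → z< ; (z< , v<) (Fin.suc i) → v< i })
    (𝟙-× (value z ℤ.<? ℤ.+ M) (below? M v))

  value≤ : (s : ±[ k ]) → value s ℤ.≤ ℤ.+ k
  value≤ {k} (mk± (ℤ.+ j)  j≤k) = ℤ.+≤+ (recompute (j ℕ.≤? k) j≤k)
  value≤     (mk± -[1+ j ] _)   = ℤ.-≤+

  -- α orders points by a ∘ β and keeps them increasing where a ∘ β ties; β turns this increase into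
  -- order for `b`. Hence βα sorts by `a` first, then by `b`, then by the point. `lex-digits`
  -- carries this over to the combined map, and sorting elements are unique. Here `a` is the
  -- overview's a ∘ sort(b)⁻¹, and `act a β` is its a.
  sort-digits : ∀ (a : Vec ±[ l ] n) (b : Vec ±[ suc k ] n) → Below (suc k) b →
    let β = sortVec (Vec.map value b) in
    Group._∙_ (𝔅-group n) β (sortVec (Vec.map value (act a β)))
      ≈𝔅 sortVec (Vec.zipWith (digits (suc k)) (Vec.map value a) (Vec.map value b))
  sort-digits {l} {n} {k} a b b< = sorted⇒≈sortVec c {βα}
    (sorted-cong {b = λ s → digits (suc k) (a̅ s) (b̅ s)} {σ = βα} {τ = βα}
      (λ s → sym (odd-extension-digits (suc k) (Vec.map value a) (Vec.map value b) s))
      (λ _ → refl)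
      λ {s} {t} s<t → lex-digits (suc k) a̅ b̅ (ℤ-ext.ext-neg (Vec.map value b)) b̅≤ b̅≡⇒<0
        {β ⟨$⟩ (α ⟨$⟩ s)} {β ⟨$⟩ (α ⟨$⟩ t)} (compare (α-sorted s<t)))
    where
    a̅ = odd-extension (Vec.map value a)
    b̅ = odd-extension (Vec.map value b)
    c = Vec.zipWith (digits (suc k)) (Vec.map value a) (Vec.map value b)
    β = sortVec (Vec.map value b)
    α = sortVec (Vec.map value (act a β))
    βα = Group._∙_ (𝔅-group n) β α

    α-sorted : Sorted (odd-extension (Vec.map value (act a β))) α
    α-sorted = sort-sorted _ (ℤ-ext.ext-neg (Vec.map value (act a β)))

    compare : ∀ {s t} → Lex (odd-extension (Vec.map value (act a β))) s t →
              a̅ (β ⟨$⟩ s) ℤ.< a̅ (β ⟨$⟩ t) ⊎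
              (a̅ (β ⟨$⟩ s) ≡ a̅ (β ⟨$⟩ t) × Lex b̅ (β ⟨$⟩ s) (β ⟨$⟩ t))
    compare {s} {t} (inj₁ as<at) =
      inj₁ (subst₂ ℤ._<_ (odd-extension-act a β s) (odd-extension-act a β t) as<at)
    compare {s} {t} (inj₂ (as≡at , s<t)) = inj₂
      ( trans (sym (odd-extension-act a β s)) (trans as≡at (odd-extension-act a β t))
      , sort-sorted b̅ (ℤ-ext.ext-neg (Vec.map value b)) s<t)

    b̅≤ : ∀ s → b̅ s ℤ.≤ ℤ.+ suc k
    b̅≤ s = subst (ℤ._≤ ℤ.+ suc k) (value-ext b s) (value≤ (±-ext.ext b s))

    b̅≡⇒<0 : ∀ s → b̅ s ≡ ℤ.+ suc k → value s ℤ.< ℤ.+ 0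
    -- At the origin the value is 0, never `suc k`: here the base has to be positive.
    b̅≡⇒<0 (mk± (ℤ.+ zero)  _)   ()
    b̅≡⇒<0 (mk± (ℤ.+ suc j) j<n) eq = contradiction (b< (fromℕ< j<n))
      (ℤ.<-irrefl (trans (sym (Vec.lookup-map (fromℕ< j<n) value b)) eq))
    b̅≡⇒<0 (mk± -[1+ j ]    j<n) eq = ℤ.-<+

  -- Sums over intervals of integers

  ∑-suc : ∀ m (f : Fin (suc m) → ℕ) → ∑ (tabulate Fin.suc) f ≡ ∑ (allFin m) (f ∘ Fin.suc)
  ∑-suc m f = trans (cong (λ xs → ∑ xs f) (sym (List.map-tabulate id Fin.suc)))
                    (∑-map Fin.suc (allFin m) f)

  ∑-allFin : ∀ m (f : Fin (suc m) → ℕ) →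
             ∑ (allFin (suc m)) f ≡ ∑ (allFin m) (f ∘ inject₁) + f (fromℕ m)
  ∑-allFin zero    f = ℕ.+-identityʳ _
  ∑-allFin (suc m) f = begin
    f Fin.zero + ∑ (tabulate Fin.suc) f
      ≡⟨ cong (f Fin.zero +_) (∑-suc (suc m) f) ⟩
    f Fin.zero + ∑ (allFin (suc m)) (f ∘ Fin.suc)
      ≡⟨ cong (f Fin.zero +_) (∑-allFin m (f ∘ Fin.suc)) ⟩
    f Fin.zero + (∑ (allFin m) (f ∘ Fin.suc ∘ inject₁) + f (fromℕ (suc m)))
      ≡⟨ sym (ℕ.+-assoc (f Fin.zero) _ _) ⟩
    f Fin.zero + ∑ (allFin m) (f ∘ inject₁ ∘ Fin.suc) + f (fromℕ (suc m))
      ≡⟨ cong (λ s → f Fin.zero + s + f (fromℕ (suc m))) (sym (∑-suc m (f ∘ inject₁))) ⟩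
    ∑ (allFin (suc m)) (f ∘ inject₁) + f (fromℕ (suc m)) ∎
    where open ≡-Reasoning

  ∑< : ℕ → (ℕ → ℕ) → ℕ
  ∑< zero    f = 0
  ∑< (suc m) f = ∑< m f + f m

  ∑<-allFin : ∀ m (f : ℕ → ℕ) → ∑ (allFin m) (f ∘ toℕ) ≡ ∑< m f
  ∑<-allFin zero    f = refl
  ∑<-allFin (suc m) f = trans (∑-allFin m (f ∘ toℕ)) (cong₂ _+_
    (trans (∑-cong (allFin m) λ i → cong f (Fin.toℕ-inject₁ i)) (∑<-allFin m f))
    (cong f (Fin.toℕ-fromℕ m)))

  ∑<-cong : ∀ m {f g : ℕ → ℕ} → (∀ {i} → i ℕ.< m → f i ≡ g i) → ∑< m f ≡ ∑< m g
  ∑<-cong zero    f≗g = refl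
  ∑<-cong (suc m) f≗g = cong₂ _+_ (∑<-cong m λ i<m → f≗g (ℕ.m<n⇒m<1+n i<m)) (f≗g ℕ.≤-refl)

  ∑<-+ : ∀ m m′ f → ∑< (m + m′) f ≡ ∑< m f + ∑< m′ (λ i → f (m + i))
  ∑<-+ m zero     f = trans (cong (λ j → ∑< j f) (ℕ.+-identityʳ m)) (sym (ℕ.+-identityʳ _))
  ∑<-+ m (suc m′) f = trans (cong (λ j → ∑< j f) (ℕ.+-suc m m′))
    (trans (cong (_+ f (m + m′)) (∑<-+ m m′ f)) (ℕ.+-assoc (∑< m f) _ _))

  -- Cutting the range into blocks of length `m′` is division with remainder by `m′`.
  ∑<-* : ∀ m m′ f → ∑< (m * m′) f ≡ ∑< m (λ i → ∑< m′ (λ j → f (i * m′ + j)))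
  ∑<-* zero    m′ f = refl
  ∑<-* (suc m) m′ f = trans (cong (λ j → ∑< j f) (ℕ.+-comm m′ (m * m′)))
    (trans (∑<-+ (m * m′) m′ f) (cong (_+ ∑< m′ (λ j → f (m * m′ + j))) (∑<-* m m′ f)))

  ∑-points : ∀ k (f : ℤ → ℕ) → ∑ (points k) (f ∘ value)
           ≡ ∑< (suc k) (f ∘ ℤ.+_) + ∑< k (f ∘ -[1+_])
  ∑-points k f = trans (∑-++ (map at (allFin (suc k))) _ (f ∘ value)) (cong₂ _+_
    (trans (∑-map at (allFin (suc k)) (f ∘ value)) (∑<-allFin (suc k) (f ∘ ℤ.+_)))
    (trans (∑-map (neg ∘ at ∘ Fin.suc) (allFin k) (f ∘ value)) (∑<-allFin k (f ∘ -[1+_]))))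

  -- `points` lists the negative values after the others; the shifted index puts all of them in
  -- increasing order, as division with remainder requires. Each induction step adds the two extreme
  -- values, one at either end.
  ∑-points-⊖ : ∀ k (f : ℤ → ℕ) → ∑ (points k) (f ∘ value) ≡ ∑< (suc (k + k)) (λ i → f (i ℤ.⊖ k))
  ∑-points-⊖ k f = trans (∑-points k f) (go k)
    where
    open ≡-Reasoning
    open ℕSolver.+-*-Solver

    go : ∀ k → ∑< (suc k) (f ∘ ℤ.+_) + ∑< k (f ∘ -[1+_]) ≡ ∑< (suc (k + k)) (λ i → f (i ℤ.⊖ k))
    go zero    = ℕ.+-identityʳ _
    go (suc k) = begin
      p + f (ℤ.+ suc k) + (m + f -[1+ k ])
        ≡⟨ solve 4 (λ p a m b → p :+ a :+ (m :+ b) := b :+ (p :+ m) :+ a) refl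
             p (f (ℤ.+ suc k)) m (f -[1+ k ]) ⟩
      f -[1+ k ] + (p + m) + f (ℤ.+ suc k)
        ≡⟨ cong (λ s → f -[1+ k ] + s + f (ℤ.+ suc k)) (go k) ⟩
      f -[1+ k ] + ∑< (suc (k + k)) (λ i → f (i ℤ.⊖ k)) + f (ℤ.+ suc k)
        ≡⟨ cong₂ (λ s z → f -[1+ k ] + s + f z)
             (∑<-cong (suc (k + k)) λ {i} _ → cong f (sym (ℤ.[1+m]⊖[1+n]≡m⊖n i k)))
             (sym top) ⟩
      f -[1+ k ] + ∑< (suc (k + k)) (λ i → f (suc i ℤ.⊖ suc k)) + f (suc (suc (k + k)) ℤ.⊖ suc k)
        ≡⟨ cong (_+ f (suc (suc (k + k)) ℤ.⊖ suc k))
             (sym (∑<-+ 1 (suc (k + k)) (λ i → f (i ℤ.⊖ suc k)))) ⟩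
      ∑< (suc (suc (suc (k + k)))) (λ i → f (i ℤ.⊖ suc k))
        ≡⟨ cong (λ j → ∑< (suc (suc j)) (λ i → f (i ℤ.⊖ suc k))) (sym (ℕ.+-suc k k)) ⟩
      ∑< (suc (suc k + suc k)) (λ i → f (i ℤ.⊖ suc k)) ∎
      where
      p = ∑< (suc k) (f ∘ ℤ.+_)
      m = ∑< k (f ∘ -[1+_])

      top : suc (suc (k + k)) ℤ.⊖ suc k ≡ ℤ.+ suc k
      top = trans (ℤ.⊖-≥ (s≤s (ℕ.m≤n⇒m≤1+n (ℕ.m≤m+n k k))))
        (cong ℤ.+_ (trans (cong (ℕ._∸ suc k) (sym (ℕ.+-suc (suc k) k))) (ℕ.m+n∸m≡n (suc k) (suc k))))

  -- The condition removes exactly the last index 2k, the one with value k.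
  ∑-points-below : ∀ k (f : ℤ → ℕ) →
    ∑ (points k) (λ z → 𝟙 (value z ℤ.<? ℤ.+ k) * f (value z)) ≡ ∑< (k + k) (λ i → f (i ℤ.⊖ k))
  ∑-points-below k f = trans (∑-points-⊖ k (λ z → 𝟙 (z ℤ.<? ℤ.+ k) * f z))
    (trans (cong₂ _+_
      (∑<-cong (k + k) λ {i} i<2k → trans
        (cong (_* f (i ℤ.⊖ k)) (𝟙-yes (i ℤ.⊖ k ℤ.<? ℤ.+ k)
          (subst (i ℤ.⊖ k ℤ.<_) top (ℤ.⊖-monoˡ-< k i<2k))))
        (ℕ.*-identityˡ _))
      (cong (_* f (k + k ℤ.⊖ k)) (𝟙-no (k + k ℤ.⊖ k ℤ.<? ℤ.+ k) λ lt → ℤ.<-irrefl top lt)))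
      (ℕ.+-identityʳ _))
    where
    top : k + k ℤ.⊖ k ≡ ℤ.+ k
    top = trans (ℤ.⊖-≥ (ℕ.m≤m+n k k)) (cong ℤ.+_ (ℕ.m+n∸m≡n k k))

  -- In shifted indices i and j the combined value is i·2k + j - K, with all shifts collected in K =
  -- 2kl + k. Division by 2k then runs through (2l + 1)·2k = 2K consecutive values, starting at -K.
  ∑-digits : ∀ l k (f : ℤ → ℕ) → let K = l * (k + k) + k in
    ∑ (points l) (λ a → ∑ (points k) λ b →
      𝟙 (value b ℤ.<? ℤ.+ k) * f (digits k (value a) (value b)))
    ≡ ∑ (points K) (λ c → 𝟙 (value c ℤ.<? ℤ.+ K) * f (value c))
  ∑-digits l k f = begin
    ∑ (points l) (λ a → ∑ (points k) λ b →
      𝟙 (value b ℤ.<? ℤ.+ k) * f (digits k (value a) (value b)))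
      ≡⟨ ∑-cong (points l) (λ a → ∑-points-below k (f ∘ digits k (value a))) ⟩
    ∑ (points l) (λ a → ∑< (k + k) λ j → f (digits k (value a) (j ℤ.⊖ k)))
      ≡⟨ ∑-points-⊖ l (λ a → ∑< (k + k) λ j → f (digits k a (j ℤ.⊖ k))) ⟩
    ∑< (suc (l + l)) (λ i → ∑< (k + k) λ j → f (digits k (i ℤ.⊖ l) (j ℤ.⊖ k)))
      ≡⟨ ∑<-cong (suc (l + l)) (λ {i} _ → ∑<-cong (k + k) λ {j} _ → cong f (carry i j)) ⟩
    ∑< (suc (l + l)) (λ i → ∑< (k + k) λ j → f (i * (k + k) + j ℤ.⊖ K))
      ≡⟨ sym (∑<-* (suc (l + l)) (k + k) (λ i → f (i ℤ.⊖ K))) ⟩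
    ∑< (suc (l + l) * (k + k)) (λ i → f (i ℤ.⊖ K))
      ≡⟨ cong (λ m → ∑< m (λ i → f (i ℤ.⊖ K))) (2K≡ l k) ⟩
    ∑< (K + K) (λ i → f (i ℤ.⊖ K))
      ≡⟨ sym (∑-points-below K f) ⟩
    ∑ (points K) (λ c → 𝟙 (value c ℤ.<? ℤ.+ K) * f (value c)) ∎
    where
    open ≡-Reasoning
    K = l * (k + k) + k

    2K≡ : ∀ l k → suc (l + l) * (k + k) ≡ l * (k + k) + k + (l * (k + k) + k)
    2K≡ = solve 2 (λ l k → (con 1 :+ (l :+ l)) :* (k :+ k)
      := l :* (k :+ k) :+ k :+ (l :* (k :+ k) :+ k)) refl
      where open ℕSolver.+-*-Solver

    carry : ∀ i j → digits k (i ℤ.⊖ l) (j ℤ.⊖ k) ≡ i * (k + k) + j ℤ.⊖ K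
    carry i j = begin
      N ℤ.* (i ℤ.⊖ l) ℤ.+ (j ℤ.⊖ k)
        ≡⟨ cong₂ (λ s t → N ℤ.* s ℤ.+ t) (sym (ℤ.m-n≡m⊖n i l)) (sym (ℤ.m-n≡m⊖n j k)) ⟩
      N ℤ.* (ℤ.+ i ℤ.- ℤ.+ l) ℤ.+ (ℤ.+ j ℤ.- ℤ.+ k)
        ≡⟨ solve 5 (λ N i l j k → N :* (i :- l) :+ (j :- k) := (i :* N :+ j) :- (l :* N :+ k)) refl
             N (ℤ.+ i) (ℤ.+ l) (ℤ.+ j) (ℤ.+ k) ⟩
      (ℤ.+ i ℤ.* N ℤ.+ ℤ.+ j) ℤ.- (ℤ.+ l ℤ.* N ℤ.+ ℤ.+ k)
        ≡⟨ cong₂ (λ s t → (s ℤ.+ ℤ.+ j) ℤ.- (t ℤ.+ ℤ.+ k))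
             (sym (ℤ.pos-* i (k + k))) (sym (ℤ.pos-* l (k + k))) ⟩
      ℤ.+ (i * (k + k) + j) ℤ.- ℤ.+ K
        ≡⟨ ℤ.m-n≡m⊖n (i * (k + k) + j) K ⟩
      i * (k + k) + j ℤ.⊖ K ∎
      where
      open ℤSolver.+-*-Solver
      N = ℤ.+ (k + k)

  -- Coordinates are independent: the bound on a vector is a product over its entries, so the first
  -- pair of digits can be summed alone, with `tail` holding the contribution of the others.
  ∑-vector-digits : ∀ l k n (f : Vec ℤ n → ℕ) → let K = l * (k + k) + k in
    ∑ (vectors (points l) n) (λ a → ∑ (vectors (points k) n) λ b →
      𝟙 (below? k b) * f (Vec.zipWith (digits k) (Vec.map value a) (Vec.map value b)))
    ≡ ∑ (vectors (points K) n) (λ c → 𝟙 (below? K c) * f (Vec.map value c))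
  ∑-vector-digits l k zero    f = ℕ.+-identityʳ _
  ∑-vector-digits l k (suc n) f = begin
    ∑ (vectors (points l) (suc n)) (λ a → ∑ (vectors (points k) (suc n)) λ b →
      𝟙 (below? k b) * f (zip a b))
      ≡⟨ ∑-vectors (points l) n _ ⟩
    ∑ (points l) (λ x → ∑ (vectors (points l) n) λ a → ∑ (vectors (points k) (suc n)) λ b →
      𝟙 (below? k b) * f (zip (x ∷ a) b))
      ≡⟨ ∑-cong (points l) (λ x → trans
           (∑-cong (vectors (points l) n) λ a → ∑-vectors (points k) n _)
           (∑-swap (vectors (points l) n) (points k) _)) ⟩
    ∑ (points l) (λ x → ∑ (points k) λ y → ∑ (vectors (points l) n) λ a →
      ∑ (vectors (points k) n) λ b → 𝟙 (below? k (y ∷ b)) * f (digits k (value x) (value y) ∷ zip a b))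
      ≡⟨ ∑-cong (points l) (λ x → ∑-cong (points k) λ y → inner x y) ⟩
    ∑ (points l) (λ x → ∑ (points k) λ y →
      𝟙 (value y ℤ.<? ℤ.+ k) * tail (digits k (value x) (value y)))
      ≡⟨ ∑-digits l k tail ⟩
    ∑ (points K) (λ z → 𝟙 (value z ℤ.<? ℤ.+ K) * tail (value z))
      ≡⟨ ∑-cong (points K) (λ z → factor K (vectors (points K) n) z (λ c → f (value z ∷ Vec.map value c))) ⟩
    ∑ (points K) (λ z → ∑ (vectors (points K) n) λ c →
      𝟙 (below? K (z ∷ c)) * f (Vec.map value (z ∷ c)))
      ≡⟨ sym (∑-vectors (points K) n _) ⟩
    ∑ (vectors (points K) (suc n)) (λ c → 𝟙 (below? K c) * f (Vec.map value c)) ∎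
    where
    open ≡-Reasoning
    K = l * (k + k) + k

    zip : ∀ {m} → Vec ±[ l ] m → Vec ±[ k ] m → Vec ℤ m
    zip a b = Vec.zipWith (digits k) (Vec.map value a) (Vec.map value b)

    tail : ℤ → ℕ
    tail z = ∑ (vectors (points K) n) λ c → 𝟙 (below? K c) * f (z ∷ Vec.map value c)

    factor : ∀ M {j} (vs : List (Vec ±[ j ] n)) (z : ±[ j ]) (g : Vec ±[ j ] n → ℕ) →
      𝟙 (value z ℤ.<? ℤ.+ M) * ∑ vs (λ c → 𝟙 (below? M c) * g c)
      ≡ ∑ vs (λ c → 𝟙 (below? M (z ∷ c)) * g c)
    factor M vs z g = trans (sym (∑-*ˡ (𝟙 (value z ℤ.<? ℤ.+ M)) vs _)) (∑-cong vs λ c →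
      trans (sym (ℕ.*-assoc (𝟙 (value z ℤ.<? ℤ.+ M)) _ (g c)))
            (cong (_* g c) (sym (𝟙-below-∷ M z c))))

    inner : ∀ x y →
      ∑ (vectors (points l) n) (λ a → ∑ (vectors (points k) n) λ b →
        𝟙 (below? k (y ∷ b)) * f (digits k (value x) (value y) ∷ zip a b))
      ≡ 𝟙 (value y ℤ.<? ℤ.+ k) * tail (digits k (value x) (value y))
    inner x y = trans
      (∑-cong (vectors (points l) n) λ a → sym (factor k (vectors (points k) n) y _))
      (trans (∑-*ˡ (𝟙 (value y ℤ.<? ℤ.+ k)) (vectors (points l) n) _)
        (cong (𝟙 (value y ℤ.<? ℤ.+ k) *_)
          (∑-vector-digits l k n (λ w → f (digits k (value x) (value y) ∷ w)))))

  -- φ(l) and ψ(k) as sums over maps {1, …, n} → [-l, l] and {1, …, n} → [-k, k-1],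
  -- paired with a function on the group.
  Φ : ∀ n → ℕ → (𝔅 n → ℕ) → ℕ
  Φ n l f = ∑ (vectors (points l) n) λ v → f (sortVec (Vec.map value v))

  Ψ : ∀ n → ℕ → (𝔅 n → ℕ) → ℕ
  Ψ n k f = ∑ (vectors (points k) n) λ v → 𝟙 (below? k v) * f (sortVec (Vec.map value v))

  -- For each `b` the inner sum is reindexed by precomposing `a` with `β b`, which brings every term
  -- into the form of `sort-digits`. That lemma requires `b` to be below the bound, so it is applied
  -- under the indicator.
  Ψ-Φ : ∀ n k l (f : 𝔅 n → ℕ) → (∀ {σ τ} → σ ≈𝔅 τ → f σ ≡ f τ) →
    Ψ n (suc k) (λ σ → Φ n l λ τ → f (Group._∙_ (𝔅-group n) σ τ))
    ≡ Ψ n (l * (suc k + suc k) + suc k) f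
  Ψ-Φ n k l f f-cong = begin
    ∑ bs (λ b → 𝟙 (below? (suc k) b) * ∑ as λ a → f (β b ∙ sortVec (Vec.map value a)))
      ≡⟨ ∑-cong bs (λ b → cong (𝟙 (below? (suc k) b) *_) (sym (∑-act (β b) _))) ⟩
    ∑ bs (λ b → 𝟙 (below? (suc k) b) * ∑ as λ a → f (β b ∙ sortVec (Vec.map value (act a (β b)))))
      ≡⟨ ∑-cong bs (λ b → trans (sym (∑-*ˡ (𝟙 (below? (suc k) b)) as _))
           (∑-cong as λ a → combine a b)) ⟩
    ∑ bs (λ b → ∑ as λ a → 𝟙 (below? (suc k) b) * f (sortVec (zip a b)))
      ≡⟨ ∑-swap bs as _ ⟩
    ∑ as (λ a → ∑ bs λ b → 𝟙 (below? (suc k) b) * f (sortVec (zip a b)))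
      ≡⟨ ∑-vector-digits l (suc k) n (f ∘ sortVec) ⟩
    Ψ n (l * (suc k + suc k) + suc k) f ∎
    where
    open ≡-Reasoning
    open Group (𝔅-group n) using (_∙_)
    as = vectors (points l) n
    bs = vectors (points (suc k)) n

    β : Vec ±[ suc k ] n → 𝔅 n
    β b = sortVec (Vec.map value b)

    zip : Vec ±[ l ] n → Vec ±[ suc k ] n → Vec ℤ n
    zip a b = Vec.zipWith (digits (suc k)) (Vec.map value a) (Vec.map value b)

    combine : ∀ a b → 𝟙 (below? (suc k) b) * f (β b ∙ sortVec (Vec.map value (act a (β b))))
                    ≡ 𝟙 (below? (suc k) b) * f (sortVec (zip a b))
    combine a b = 𝟙-*-cong (below? (suc k) b) λ b< → f-cong (sort-digits a b b<)

  -- Counting chains with prescribed strict steps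

  Chain : (Fin n → ℕ) → ℤ → Vec ±[ k ] n → Set
  Chain s p []      = ⊤
  Chain s p (z ∷ d) = p ℤ.+ ℤ.+ s Fin.zero ℤ.≤ value z × Chain (s ∘ Fin.suc) (value z) d

  chain? : (s : Fin n → ℕ) (p : ℤ) (d : Vec ±[ k ] n) → Dec (Chain s p d)
  chain? s p []      = yes tt
  chain? s p (z ∷ d) = (p ℤ.+ ℤ.+ s Fin.zero ℤ.≤? value z) ×-dec chain? (s ∘ Fin.suc) (value z) d

  -- Pascal's rule, by induction on `m`. The full identity also sums the terms i C n with i below
  -- `c`; these vanish because c ≤ n, which is the base case.
  hockey-stick : ∀ m c n → c ≤ n → ∑< m (λ i → (m ℕ.∸ suc i + c) C n) ≡ (m + c) C suc n
  hockey-stick zero    c n c≤n = sym (k>n⇒nCk≡0 (s≤s c≤n))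
  hockey-stick (suc m) c n c≤n = begin
    ∑< (suc m) (λ i → (suc m ℕ.∸ suc i + c) C n)
      ≡⟨ ∑<-+ 1 m (λ i → (suc m ℕ.∸ suc i + c) C n) ⟩
    (m + c) C n + ∑< m (λ i → (m ℕ.∸ suc i + c) C n)
      ≡⟨ cong ((m + c) C n +_) (hockey-stick m c n c≤n) ⟩
    (m + c) C n + (m + c) C suc n
      ≡⟨ nCk+nC[k+1]≡[n+1]C[k+1] (m + c) n ⟩
    suc (m + c) C suc n ∎
    where open ≡-Reasoning

  ∑<-zero : ∀ m {f} → (∀ {i} → i ℕ.< m → f i ≡ 0) → ∑< m f ≡ 0
  ∑<-zero zero    f≡0 = refl
  ∑<-zero (suc m) f≡0 = cong₂ _+_ (∑<-zero m λ i<m → f≡0 (ℕ.m<n⇒m<1+n i<m)) (f≡0 ℕ.≤-refl)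

  ∑-points-window : ∀ k q m → q + m ≤ suc k → (f : ℤ → ℕ) →
    ∑ (points k) (λ z → 𝟙 (value z ℤ.<? ℤ.+ (q + m)) * (𝟙 (ℤ.+ q ℤ.≤? value z) * f (value z)))
    ≡ ∑< m (λ i → f (ℤ.+ (q + i)))
  ∑-points-window k q m q+m≤1+k f = begin
    ∑ (points k) (λ z → g (value z))
      ≡⟨ ∑-points k g ⟩
    ∑< (suc k) (g ∘ ℤ.+_) + ∑< k (g ∘ -[1+_])
      ≡⟨ cong₂ _+_ (cong (λ j → ∑< j (g ∘ ℤ.+_)) (sym (ℕ.m+[n∸m]≡n q+m≤1+k)))
           (∑<-zero k λ {i} _ → small { -[1+ i ]} ℤ.-<+) ⟩
    ∑< (q + m + (suc k ℕ.∸ (q + m))) (g ∘ ℤ.+_) + 0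
      ≡⟨ trans (ℕ.+-identityʳ _) (trans (∑<-+ (q + m) _ (g ∘ ℤ.+_))
           (cong (∑< (q + m) (g ∘ ℤ.+_) +_) (∑<-zero (suc k ℕ.∸ (q + m)) λ {i} _ → large i))) ⟩
    ∑< (q + m) (g ∘ ℤ.+_) + 0
      ≡⟨ trans (ℕ.+-identityʳ _) (∑<-+ q m (g ∘ ℤ.+_)) ⟩
    ∑< q (g ∘ ℤ.+_) + ∑< m (λ i → g (ℤ.+ (q + i)))
      ≡⟨ cong₂ _+_ (∑<-zero q λ i<q → small (ℤ.+<+ i<q)) (∑<-cong m λ i<m → middle i<m) ⟩
    ∑< m (λ i → f (ℤ.+ (q + i))) ∎
    where
    open ≡-Reasoning

    g : ℤ → ℕ
    g z = 𝟙 (z ℤ.<? ℤ.+ (q + m)) * (𝟙 (ℤ.+ q ℤ.≤? z) * f z)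

    small : ∀ {z} → z ℤ.< ℤ.+ q → g z ≡ 0
    small {z} z<q = trans (cong (λ j → 𝟙 (z ℤ.<? ℤ.+ (q + m)) * (j * f z))
                            (𝟙-no (ℤ.+ q ℤ.≤? z) (ℤ.<⇒≱ z<q)))
                          (ℕ.*-zeroʳ (𝟙 (z ℤ.<? ℤ.+ (q + m))))

    large : ∀ i → g (ℤ.+ (q + m + i)) ≡ 0
    large i = cong (_* (𝟙 (ℤ.+ q ℤ.≤? z) * f z))
      (𝟙-no (z ℤ.<? ℤ.+ (q + m)) (ℤ.≤⇒≯ (ℤ.+≤+ (ℕ.m≤m+n (q + m) i))))
      where z = ℤ.+ (q + m + i)

    middle : ∀ {i} → i ℕ.< m → g (ℤ.+ (q + i)) ≡ f (ℤ.+ (q + i))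
    middle {i} i<m = trans
      (cong₂ (λ a b → a * (b * f z))
        (𝟙-yes (z ℤ.<? ℤ.+ (q + m)) (ℤ.+<+ (ℕ.+-monoʳ-< q i<m)))
        (𝟙-yes (ℤ.+ q ℤ.≤? z) (ℤ.+≤+ (ℕ.m≤m+n q i))))
      (trans (ℕ.+-identityʳ _) (ℕ.+-identityʳ _))
      where z = ℤ.+ (q + i)

  ∑-allFin-≤ : ∀ n (s : Fin n → ℕ) → (∀ i → s i ≤ 1) → ∑ (allFin n) s ≤ n
  ∑-allFin-≤ n s s≤1 = ℕ.≤-trans (∑-mono (allFin n) s≤1)
    (ℕ.≤-reflexive (trans (∑-1 (allFin n)) (List.length-tabulate {n = n} id)))

  chain-count : ∀ n (s : Fin n → ℕ) → (∀ i → s i ≤ 1) → ∀ {c p j M} →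
    c + ∑ (allFin n) s ≡ n → p + suc j ≡ M → M ≤ suc k →
    ∑ (vectors (points k) n) (λ d → 𝟙 (below? M d) * 𝟙 (chain? s (ℤ.+ p) d)) ≡ (j + c) C n
  chain-count         zero    s s≤1 _     _       _    = refl
  chain-count {k = k} (suc n) s s≤1 {c} {p} {j} {M} c+s≡n p+1+j≡M M≤1+k = begin
    ∑ (vectors (points k) (suc n)) (λ d → 𝟙 (below? M d) * 𝟙 (chain? s (ℤ.+ p) d))
      ≡⟨ ∑-vectors (points k) n _ ⟩
    ∑ (points k) (λ z → ∑ (vectors (points k) n) λ d →
      𝟙 (below? M (z ∷ d)) * 𝟙 (chain? s (ℤ.+ p) (z ∷ d)))
      ≡⟨ ∑-cong (points k) factor ⟩
    ∑ (points k) (λ z → 𝟙 (value z ℤ.<? ℤ.+ M) * (𝟙 (ℤ.+ q ℤ.≤? value z) * rest (value z)))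
      ≡⟨ count (split (s Fin.zero) (s≤1 Fin.zero)
           (trans (cong (c +_) (cong (s Fin.zero +_) (sym (∑-suc n s)))) c+s≡n)) ⟩
    (j + c) C suc n ∎
    where
    open ≡-Reasoning
    s′ = ∑ (allFin n) (s ∘ Fin.suc)
    q = p + s Fin.zero

    rest : ℤ → ℕ
    rest z = ∑ (vectors (points k) n) λ d → 𝟙 (below? M d) * 𝟙 (chain? (s ∘ Fin.suc) z d)

    s′≤n : s′ ≤ n
    s′≤n = ∑-allFin-≤ n (s ∘ Fin.suc) (s≤1 ∘ Fin.suc)

    factor : ∀ z →
      ∑ (vectors (points k) n) (λ d → 𝟙 (below? M (z ∷ d)) * 𝟙 (chain? s (ℤ.+ p) (z ∷ d)))
      ≡ 𝟙 (value z ℤ.<? ℤ.+ M) * (𝟙 (ℤ.+ q ℤ.≤? value z) * rest (value z))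
    factor z = trans
      (∑-cong (vectors (points k) n) λ d → trans
        (cong₂ _*_ (𝟙-below-∷ M z d) (𝟙-× (ℤ.+ q ℤ.≤? value z) (chain? (s ∘ Fin.suc) (value z) d)))
        (solve 4 (λ a b c d → a :* b :* (c :* d) := a :* c :* (b :* d)) refl
          (𝟙 (value z ℤ.<? ℤ.+ M)) (𝟙 (below? M d)) (𝟙 (ℤ.+ q ℤ.≤? value z))
          (𝟙 (chain? (s ∘ Fin.suc) (value z) d))))
      (trans (∑-*ˡ (𝟙 (value z ℤ.<? ℤ.+ M) * 𝟙 (ℤ.+ q ℤ.≤? value z)) (vectors (points k) n) _)
        (ℕ.*-assoc (𝟙 (value z ℤ.<? ℤ.+ M)) _ (rest (value z))))
      where open ℕSolver.+-*-Solver

    split : ∀ s₀ → s₀ ≤ 1 → c + (s₀ + s′) ≡ suc n →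
            ∃ λ m → ∃ λ c′ → p + s₀ + m ≡ M × c′ + s′ ≡ n × m + c′ ≡ j + c
    split zero          _   eq = suc j , n ℕ.∸ s′ ,
      trans (cong (_+ suc j) (ℕ.+-identityʳ p)) p+1+j≡M , ℕ.m∸n+n≡m s′≤n ,
      trans (sym (ℕ.+-suc j (n ℕ.∸ s′))) (cong (j +_) (ℕ.+-cancelʳ-≡ s′ _ c
        (trans (cong suc (ℕ.m∸n+n≡m s′≤n)) (sym eq))))
    split (suc zero)    _   eq = j , c ,
      trans (ℕ.+-assoc p 1 j) p+1+j≡M , ℕ.suc-injective (trans (sym (ℕ.+-suc c s′)) eq) , refl
    split (suc (suc _)) (s≤s ()) eq

    count : (∃ λ m → ∃ λ c′ → q + m ≡ M × c′ + s′ ≡ n × m + c′ ≡ j + c) →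
      ∑ (points k) (λ z → 𝟙 (value z ℤ.<? ℤ.+ M) * (𝟙 (ℤ.+ q ℤ.≤? value z) * rest (value z)))
      ≡ (j + c) C suc n
    count (m , c′ , q+m≡M , c′+s′≡n , m+c′≡j+c) = begin
      ∑ (points k) (λ z → 𝟙 (value z ℤ.<? ℤ.+ M) * (𝟙 (ℤ.+ q ℤ.≤? value z) * rest (value z)))
        ≡⟨ cong (λ N → ∑ (points k) λ z →
             𝟙 (value z ℤ.<? ℤ.+ N) * (𝟙 (ℤ.+ q ℤ.≤? value z) * rest (value z))) (sym q+m≡M) ⟩
      ∑ (points k) (λ z → 𝟙 (value z ℤ.<? ℤ.+ (q + m)) * (𝟙 (ℤ.+ q ℤ.≤? value z) * rest (value z)))
        ≡⟨ ∑-points-window k q m (ℕ.≤-trans (ℕ.≤-reflexive q+m≡M) M≤1+k) rest ⟩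
      ∑< m (λ i → rest (ℤ.+ (q + i)))
        ≡⟨ ∑<-cong m (λ {i} i<m → chain-count n (s ∘ Fin.suc) (s≤1 ∘ Fin.suc) c′+s′≡n
             (trans (ℕ.+-assoc q i _) (trans (cong (q +_)
               (trans (ℕ.+-suc i _) (ℕ.m+[n∸m]≡n i<m))) q+m≡M)) M≤1+k) ⟩
      ∑< m (λ i → (m ℕ.∸ suc i + c′) C n)
        ≡⟨ hockey-stick m c′ n (ℕ.≤-trans (ℕ.m≤m+n c′ s′) (ℕ.≤-reflexive c′+s′≡n)) ⟩
      (m + c′) C suc n
        ≡⟨ cong (_C suc n) m+c′≡j+c ⟩
      (j + c) C suc n ∎

  chain-lookup : (s : Fin n → ℕ) (p : ℤ) (d : Vec ±[ k ] n) → Chain s p d → ∀ i →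
    Vec.lookup (p ∷ Vec.map value d) (inject₁ i) ℤ.+ ℤ.+ s i ℤ.≤ Vec.lookup (Vec.map value d) i
  chain-lookup s p (z ∷ d) (p≤z , _) Fin.zero    = p≤z
  chain-lookup s p (z ∷ d) (_ , ch)  (Fin.suc i) = chain-lookup (s ∘ Fin.suc) (value z) d ch i

  lookup-chain : (s : Fin n → ℕ) (p : ℤ) (d : Vec ±[ k ] n) →
    (∀ i → Vec.lookup (p ∷ Vec.map value d) (inject₁ i) ℤ.+ ℤ.+ s i ℤ.≤ Vec.lookup (Vec.map value d) i) →
    Chain s p d
  lookup-chain s p []      _  = tt
  lookup-chain s p (z ∷ d) ch = ch Fin.zero , lookup-chain (s ∘ Fin.suc) (value z) d (ch ∘ Fin.suc)

  odd-extension-inject₁ : (w : Vec ℤ n) → ∀ i →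
    odd-extension w (at (inject₁ i)) ≡ Vec.lookup (ℤ.+ 0 ∷ w) (inject₁ i)
  odd-extension-inject₁ w Fin.zero    = refl
  odd-extension-inject₁ w (Fin.suc i) = ℤ-ext.ext-at w (inject₁ i)

  descents : 𝔅 n → Fin n → ℕ
  descents σ i = 𝟙 (descent? σ i)

  Climbs : (±[ n ] → ℤ) → 𝔅 n → Set
  Climbs b σ = ∀ i → b (σ ⟨$⟩ at (inject₁ i)) ℤ.+ ℤ.+ descents σ i ℤ.≤ b (σ ⟨$⟩ at (Fin.suc i))

  sorted⇒climbs : (b : ±[ n ] → ℤ) (σ : 𝔅 n) → Sorted b σ → Climbs b σ
  sorted⇒climbs b σ σ-sorted i with descent? σ i | σ-sorted {at (inject₁ i)} {at (Fin.suc i)} i<1+i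
    where
    i<1+i : ℤ.+ toℕ (inject₁ i) ℤ.< ℤ.+ suc (toℕ i)
    i<1+i = ℤ.+<+ (s≤s (ℕ.≤-reflexive (Fin.toℕ-inject₁ i)))
  ... | yes _   | inj₁ b<         = ℤ.≤-trans
    (ℤ.≤-reflexive (ℤ.+-comm (b (σ ⟨$⟩ at (inject₁ i))) (ℤ.+ 1))) (ℤ.i<j⇒suc[i]≤j b<)
  ... | yes σ>  | inj₂ (_ , σ<)   = contradiction σ> (ℤ.<-asym σ<)
  ... | no _    | inj₁ b<         = ℤ.≤-trans (ℤ.≤-reflexive (ℤ.+-identityʳ _)) (ℤ.<⇒≤ b<)
  ... | no _    | inj₂ (b≡ , _)   = ℤ.≤-reflexive (trans (ℤ.+-identityʳ _) b≡)

  module _ {n : ℕ} (b : ±[ n ] → ℤ) (b-odd : Odd b) (σ : 𝔅 n) where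
    private
      _◃_ : ±[ n ] → ±[ n ] → Set
      s ◃ t = Lex b (σ ⟨$⟩ s) (σ ⟨$⟩ t)

      ◃-trans : ∀ {s t u} → s ◃ t → t ◃ u → s ◃ u
      ◃-trans {s} {t} {u} = lex-trans b {σ ⟨$⟩ s} {σ ⟨$⟩ t} {σ ⟨$⟩ u}

      ◃-neg : ∀ {s t} → neg s ◃ neg t → t ◃ s
      ◃-neg {s} {t} -s◃-t = subst₂ (Lex b) (double t) (double s)
        (lex-neg b-odd {σ ⟨$⟩ neg s} {σ ⟨$⟩ neg t} -s◃-t)
        where
        double : ∀ u → neg (σ ⟨$⟩ neg u) ≡ σ ⟨$⟩ u
        double u = trans (sym (odd σ (neg u))) (cong (σ ⟨$⟩_) (neg-involutive u))

    climbs⇒sorted : Climbs b σ → Sorted b σ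
    climbs⇒sorted climbs {s} {t} = all s t
      where
      step : ∀ i → at (inject₁ i) ◃ at (Fin.suc i)
      step i with descent? σ i | climbs i
      ... | yes _  | b< = inj₁ (ℤ.suc[i]≤j⇒i<j (ℤ.≤-trans
        (ℤ.≤-reflexive (ℤ.+-comm (ℤ.+ 1) (b (σ ⟨$⟩ at (inject₁ i))))) b<))
      ... | no σ≯ | b≤ with lex-cmp b (σ ⟨$⟩ at (inject₁ i)) (σ ⟨$⟩ at (Fin.suc i))
      ...   | tri< σi◃ _ _ = σi◃
      ...   | tri≈ _ eq _  = contradiction
        (cong value (trans (sym (Inverse.strictlyInverseʳ (bijection σ) (at (inject₁ i))))
          (trans (cong (𝔅.from σ) eq) (Inverse.strictlyInverseʳ (bijection σ) (at (Fin.suc i))))))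
        λ eq → ℕ.1+n≢n (trans (sym (ℤ.+-injective eq)) (Fin.toℕ-inject₁ i))
      ...   | tri> _ _ (inj₁ b>)       = contradiction
        (ℤ.≤-trans (ℤ.≤-reflexive (sym (ℤ.+-identityʳ _))) b≤) (ℤ.<⇒≱ b>)
      ...   | tri> _ _ (inj₂ (_ , σ>)) = contradiction σ> σ≯

      next : ∀ j .(j<n : j ℕ.< n) → mk± (ℤ.+ j) (ℕ.<⇒≤ j<n) ◃ mk± (ℤ.+ suc j) j<n
      next j j<n = subst₂ _◃_
        (value-injective (cong ℤ.+_ (trans (Fin.toℕ-inject₁ _) (Fin.toℕ-fromℕ< j<n))))
        (value-injective (cong (ℤ.+_ ∘ suc) (Fin.toℕ-fromℕ< j<n)))
        (step (fromℕ< j<n))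

      upward : ∀ i j .(i≤n : i ℕ.≤ n) .(j≤n : j ℕ.≤ n) → i ℕ.< j →
               mk± (ℤ.+ i) i≤n ◃ mk± (ℤ.+ j) j≤n
      upward i (suc j) i≤n j<n i<1+j with ℕ.m<1+n⇒m<n∨m≡n i<1+j
      ... | inj₁ i<j  = ◃-trans {mk± (ℤ.+ i) i≤n} {mk± (ℤ.+ j) (ℕ.<⇒≤ j<n)} {mk± (ℤ.+ suc j) j<n}
        (upward i j i≤n (ℕ.<⇒≤ j<n) i<j) (next j j<n)
      ... | inj₂ refl = next j j<n

      all : ∀ s t → value s ℤ.< value t → s ◃ t
      all (mk± (ℤ.+ i)  i≤n) (mk± (ℤ.+ j)  j≤n) (ℤ.+<+ i<j) = upward i j i≤n j≤n i<j
      all (mk± -[1+ i ] i<n) (mk± -[1+ j ] j<n) (ℤ.-<- j<i) =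
        ◃-neg {mk± -[1+ j ] j<n} {mk± -[1+ i ] i<n} (upward (suc j) (suc i) j<n i<n (s≤s j<i))
      all (mk± -[1+ i ] i<n) (mk± (ℤ.+ zero)  j≤n) ℤ.-<+ =
        ◃-neg {mk± (ℤ.+ 0) j≤n} {mk± -[1+ i ] i<n} (upward 0 (suc i) j≤n i<n ℕ.z<s)
      all (mk± -[1+ i ] i<n) (mk± (ℤ.+ suc j) j<n) ℤ.-<+ =
        ◃-trans {mk± -[1+ i ] i<n} {at Fin.zero} {mk± (ℤ.+ suc j) j<n}
          (◃-neg {at Fin.zero} {mk± -[1+ i ] i<n} (upward 0 (suc i) z≤n i<n ℕ.z<s))
          (upward 0 (suc j) z≤n j<n ℕ.z<s)

  module _ {n k : ℕ} (σ : 𝔅 n) (d : Vec ±[ k ] n) where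
    open Group (𝔅-group n) using (_⁻¹; inverseˡ; inverseʳ)
    private
      v = act d (σ ⁻¹)
      b = odd-extension (Vec.map value v)
      e = odd-extension (Vec.map value d)

      b∘σ : ∀ s → b (σ ⟨$⟩ s) ≡ e s
      b∘σ s = trans (odd-extension-act d (σ ⁻¹) (σ ⟨$⟩ s)) (cong e (inverseˡ σ s))

      e-suc : ∀ i → e (at (Fin.suc i)) ≡ value (Vec.lookup d i)
      e-suc i = trans (ℤ-ext.ext-at (Vec.map value d) i) (Vec.lookup-map i value d)

      b-suc : ∀ j → b (at (Fin.suc j)) ≡ value (Vec.lookup v j)
      b-suc j = trans (ℤ-ext.ext-at (Vec.map value v) j) (Vec.lookup-map j value v)

      chain⇒sorted : Chain (descents σ) (ℤ.+ 0) d → Sorted b σ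
      chain⇒sorted ch = climbs⇒sorted b (ℤ-ext.ext-neg (Vec.map value v)) σ λ i → subst₂ ℤ._≤_
        (cong (ℤ._+ ℤ.+ descents σ i) (sym (trans (b∘σ (at (inject₁ i)))
          (odd-extension-inject₁ (Vec.map value d) i))))
        (sym (trans (b∘σ (at (Fin.suc i))) (ℤ-ext.ext-at (Vec.map value d) i)))
        (chain-lookup (descents σ) (ℤ.+ 0) d ch i)

      sorted⇒chain : Sorted b σ → Chain (descents σ) (ℤ.+ 0) d
      sorted⇒chain σ-sorted = lookup-chain (descents σ) (ℤ.+ 0) d λ i → subst₂ ℤ._≤_
        (cong (ℤ._+ ℤ.+ descents σ i) (trans (b∘σ (at (inject₁ i)))
          (odd-extension-inject₁ (Vec.map value d) i)))
        (trans (b∘σ (at (Fin.suc i))) (ℤ-ext.ext-at (Vec.map value d) i))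
        (sorted⇒climbs b σ σ-sorted i)

    𝟙-sort : 𝟙 (σ ≟𝔅 sortVec (Vec.map value (act d (σ ⁻¹)))) ≡ 𝟙 (chain? (descents σ) (ℤ.+ 0) d)
    𝟙-sort = 𝟙-⇔ (σ ≟𝔅 sortVec (Vec.map value v)) (chain? (descents σ) (ℤ.+ 0) d)
      (λ σ≈sort → sorted⇒chain (sorted-cong {b = b} {σ = sortVec (Vec.map value v)} {τ = σ} (λ _ → refl)
        (λ s → sym (σ≈sort s)) (sort-sorted b (ℤ-ext.ext-neg (Vec.map value v)))))
      (λ ch → sorted⇒≈sortVec (Vec.map value v) {σ} (chain⇒sorted ch))

    module _ (ch : Chain (descents σ) (ℤ.+ 0) d) where
      private
        e-mono : ∀ {s t} → value s ℤ.< value t → e s ℤ.≤ e t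
        e-mono {s} {t} s<t with chain⇒sorted ch {s} {t} s<t
        ... | inj₁ b<       = subst₂ ℤ._≤_ (b∘σ s) (b∘σ t) (ℤ.<⇒≤ b<)
        ... | inj₂ (b≡ , _) = ℤ.≤-reflexive (trans (sym (b∘σ s)) (trans b≡ (b∘σ t)))

        top : ∀ s → s ≡ at (fromℕ n) ⊎ value s ℤ.< value (at (fromℕ n))
        top s with ℤ.<-cmp (value s) (value (at (fromℕ n)))
        ... | tri< s<n _ _ = inj₂ s<n
        ... | tri≈ _ s≡n _ = inj₁ (value-injective {s = s} {t = at (fromℕ n)} s≡n)
        ... | tri> _ _ n<s = contradiction n<s
          (ℤ.≤⇒≯ (subst (λ j → value s ℤ.≤ ℤ.+ j) (sym (Fin.toℕ-fromℕ n)) (value≤ s)))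

        e≤top : ∀ s → e s ℤ.≤ e (at (fromℕ n))
        e≤top s with top s
        ... | inj₁ refl = ℤ.≤-refl
        ... | inj₂ s<n  = e-mono {s} {at (fromℕ n)} s<n

        v-lookup : ∀ j → value (Vec.lookup v j) ≡ e ((σ ⁻¹) ⟨$⟩ at (Fin.suc j))
        v-lookup j = trans (sym (b-suc j)) (odd-extension-act d (σ ⁻¹) (at (Fin.suc j)))

      below-positive : ∀ M → value (σ ⟨$⟩ at (fromℕ n)) ℤ.> ℤ.+ 0 → Below M v → Below M d
      below-positive M σn>0 v< i = ℤ.≤-<-trans
        (ℤ.≤-trans (ℤ.≤-reflexive (sym (e-suc i))) (e≤top (at (Fin.suc i))))
        (subst (ℤ._< ℤ.+ M) (b∘σ (at (fromℕ n))) (b< (σ ⟨$⟩ at (fromℕ n)) σn>0))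
        where
        b< : ∀ s → value s ℤ.> ℤ.+ 0 → b s ℤ.< ℤ.+ M
        b< (mk± (ℤ.+ zero)  _)   (ℤ.+<+ ())
        b< (mk± (ℤ.+ suc j) j<n) _ = subst (ℤ._< ℤ.+ M)
          (sym (Vec.lookup-map (fromℕ< j<n) value v)) (v< (fromℕ< j<n))

      below-act : ∀ M → 0 ℕ.< n → Below M d → Below M v
      below-act M (s≤s _) d< j = ℤ.≤-<-trans
        (ℤ.≤-trans (ℤ.≤-reflexive (v-lookup j)) (e≤top ((σ ⁻¹) ⟨$⟩ at (Fin.suc j))))
        (subst (ℤ._< ℤ.+ M) (sym (e-suc (fromℕ _))) (d< (fromℕ _)))

      -- If the value k were attained at a positive point σ u, then e u = e n = k, so σ u ≤ σ n ≤ 0.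
      below-nonpositive : ¬ (value (σ ⟨$⟩ at (fromℕ n)) ℤ.> ℤ.+ 0) → Below k v
      below-nonpositive σn≯0 j with top ((σ ⁻¹) ⟨$⟩ at (Fin.suc j))
      ... | inj₁ u≡n = contradiction
        (subst (λ s → value s ℤ.> ℤ.+ 0) (trans (sym (inverseʳ σ (at (Fin.suc j)))) (cong (σ ⟨$⟩_) u≡n))
          (ℤ.+<+ ℕ.z<s)) σn≯0
      ... | inj₂ u<n with chain⇒sorted ch {(σ ⁻¹) ⟨$⟩ at (Fin.suc j)} {at (fromℕ n)} u<n
      ...   | inj₁ b< = ℤ.<-≤-trans
        (subst (ℤ._< b (σ ⟨$⟩ at (fromℕ n))) (trans (cong b (inverseʳ σ (at (Fin.suc j)))) (b-suc j)) b<)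
        (subst (ℤ._≤ ℤ.+ k) (value-ext v (σ ⟨$⟩ at (fromℕ n))) (value≤ (±-ext.ext v (σ ⟨$⟩ at (fromℕ n)))))
      ...   | inj₂ (_ , σu<σn) = contradiction
        (ℤ.<-trans (ℤ.+<+ ℕ.z<s) (subst (λ s → value s ℤ.< value (σ ⟨$⟩ at (fromℕ n)))
          (inverseʳ σ (at (Fin.suc j))) σu<σn)) σn≯0

  des-∑ : (σ : 𝔅 n) → des σ ≡ ∑ (allFin n) (descents σ)
  des-∑ {n} σ = length-filter-∑ (descent? σ) (allFin n)

  descents≤1 : (σ : 𝔅 n) → ∀ i → descents σ i ≤ 1
  descents≤1 σ i with descent? σ i
  ... | yes _ = ℕ.≤-refl
  ... | no _  = z≤n

  des≤n : (σ : 𝔅 n) → des σ ≤ n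
  des≤n {n} σ = subst (_≤ n) (sym (des-∑ σ)) (∑-allFin-≤ n (descents σ) (descents≤1 σ))

  positive? : (σ : 𝔅 n) → Dec (value (σ ⟨$⟩ at (fromℕ n)) ℤ.> ℤ.+ 0)
  positive? {n} σ = ℤ.+ 0 ℤ.<? value (σ ⟨$⟩ at (fromℕ n))

  positive⇒0<n : (σ : 𝔅 n) → value (σ ⟨$⟩ at (fromℕ n)) ℤ.> ℤ.+ 0 → 0 ℕ.< n
  positive⇒0<n {zero}  σ σn>0 = contradiction
    (subst (λ s → value s ℤ.> ℤ.+ 0) (0-fixed σ) σn>0) (ℤ.<-irrefl refl)
  positive⇒0<n {suc n} σ σn>0 = ℕ.z<s

  ades-des : (σ : 𝔅 n) → ades σ ≡ des σ + 𝟙 (positive? σ)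
  ades-des {n} σ = begin
    ades σ
      ≡⟨ length-filter-∑ (augmentedDescent? σ) (allFin (suc n)) ⟩
    ∑ (allFin (suc n)) (λ i → 𝟙 (augmentedDescent? σ i))
      ≡⟨ ∑-allFin n (λ i → 𝟙 (augmentedDescent? σ i)) ⟩
    ∑ (allFin n) (λ i → 𝟙 (augmentedDescent? σ (inject₁ i))) + 𝟙 (augmentedDescent? σ (fromℕ n))
      ≡⟨ cong₂ _+_
           (∑-cong (allFin n) λ i → 𝟙-⇔ (augmentedDescent? σ (inject₁ i)) (descent? σ i)
             (λ { (inj₁ (j , i≡j , >)) → subst (Descent σ) (sym (Fin.inject₁-injective i≡j)) >
                ; (inj₂ (i≡n , _)) → contradiction (sym i≡n) Fin.fromℕ≢inject₁ })
             (λ > → inj₁ (i , refl , >)))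
           (𝟙-⇔ (augmentedDescent? σ (fromℕ n)) (positive? σ)
             (λ { (inj₁ (j , n≡j , _)) → contradiction n≡j Fin.fromℕ≢inject₁
                ; (inj₂ (_ , >)) → > })
             (λ > → inj₂ (refl , >))) ⟩
    ∑ (allFin n) (descents σ) + 𝟙 (positive? σ)
      ≡⟨ cong (_+ 𝟙 (positive? σ)) (sym (des-∑ σ)) ⟩
    des σ + 𝟙 (positive? σ) ∎
    where open ≡-Reasoning

  ades≤1+n : (σ : 𝔅 n) → ades σ ≤ suc n
  ades≤1+n {n} σ = ℕ.≤-trans (List.length-filter (augmentedDescent? σ) (allFin (suc n)))
    (ℕ.≤-reflexive (List.length-tabulate {n = suc n} id))

  chains : ∀ k (σ : 𝔅 n) M j → suc j ≡ M → M ≤ suc k →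
    ∑ (vectors (points k) n) (λ d → 𝟙 (below? M d) * 𝟙 (chain? (descents σ) (ℤ.+ 0) d))
    ≡ (j + n ℕ.∸ des σ) C n
  chains {n} k σ M j 1+j≡M M≤1+k = trans
    (chain-count n (descents σ) (descents≤1 σ)
      (trans (cong (n ℕ.∸ des σ +_) (sym (des-∑ σ))) (ℕ.m∸n+n≡m (des≤n σ))) 1+j≡M M≤1+k)
    (cong (_C n) (sym (ℕ.+-∸-assoc j (des≤n σ))))

  below-max : (d : Vec ±[ k ] n) → Below (suc k) d
  below-max d i = ℤ.≤-<-trans (value≤ (Vec.lookup d i)) (ℤ.+<+ ℕ.≤-refl)

  Φ-count : ∀ l (σ : 𝔅 n) →
    ∑ (vectors (points l) n) (λ v → 𝟙 (σ ≟𝔅 sortVec (Vec.map value v))) ≡ (l + n ℕ.∸ des σ) C n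
  Φ-count {n} l σ = begin
    ∑ (vectors (points l) n) (λ v → 𝟙 (σ ≟𝔅 sortVec (Vec.map value v)))
      ≡⟨ sym (∑-act (σ ⁻¹) _) ⟩
    ∑ (vectors (points l) n) (λ d → 𝟙 (σ ≟𝔅 sortVec (Vec.map value (act d (σ ⁻¹)))))
      ≡⟨ ∑-cong (vectors (points l) n) (λ d → trans (𝟙-sort σ d) (sym (trans
           (cong (_* 𝟙 (chain? (descents σ) (ℤ.+ 0) d)) (𝟙-yes (below? (suc l) d) (below-max d)))
           (ℕ.*-identityˡ _)))) ⟩
    ∑ (vectors (points l) n) (λ d → 𝟙 (below? (suc l) d) * 𝟙 (chain? (descents σ) (ℤ.+ 0) d))
      ≡⟨ chains l σ (suc l) l refl ℕ.≤-refl ⟩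
    (l + n ℕ.∸ des σ) C n ∎
    where
    open ≡-Reasoning
    open Group (𝔅-group n) using (_⁻¹)

  Ψ-count : ∀ k (σ : 𝔅 n) →
    ∑ (vectors (points (suc k)) n) (λ v → 𝟙 (below? (suc k) v) * 𝟙 (σ ≟𝔅 sortVec (Vec.map value v)))
    ≡ (suc k + n ℕ.∸ ades σ) C n
  Ψ-count {n} k σ = begin
    ∑ vs (λ v → 𝟙 (below? (suc k) v) * 𝟙 (σ ≟𝔅 sortVec (Vec.map value v)))
      ≡⟨ sym (∑-act (σ ⁻¹) _) ⟩
    ∑ vs (λ d → 𝟙 (below? (suc k) (act d (σ ⁻¹))) * 𝟙 (σ ≟𝔅 sortVec (Vec.map value (act d (σ ⁻¹)))))
      ≡⟨ ∑-cong vs (λ d → trans (cong (𝟙 (below? (suc k) (act d (σ ⁻¹))) *_) (𝟙-sort σ d))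
           (ℕ.*-comm (𝟙 (below? (suc k) (act d (σ ⁻¹)))) _)) ⟩
    ∑ vs (λ d → 𝟙 (chain? (descents σ) (ℤ.+ 0) d) * 𝟙 (below? (suc k) (act d (σ ⁻¹))))
      ≡⟨ by-sign (positive? σ) ⟩
    (suc k + n ℕ.∸ (des σ + 𝟙 (positive? σ))) C n
      ≡⟨ cong (λ a → (suc k + n ℕ.∸ a) C n) (sym (ades-des σ)) ⟩
    (suc k + n ℕ.∸ ades σ) C n ∎
    where
    open ≡-Reasoning
    open Group (𝔅-group n) using (_⁻¹)
    vs = vectors (points (suc k)) n

    replace : ∀ M → (∀ d → Chain (descents σ) (ℤ.+ 0) d →
                       (Below (suc k) (act d (σ ⁻¹)) → Below M d) ×
                       (Below M d → Below (suc k) (act d (σ ⁻¹)))) →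
      ∑ vs (λ d → 𝟙 (chain? (descents σ) (ℤ.+ 0) d) * 𝟙 (below? (suc k) (act d (σ ⁻¹))))
      ≡ ∑ vs (λ d → 𝟙 (below? M d) * 𝟙 (chain? (descents σ) (ℤ.+ 0) d))
    replace M ⇔ = ∑-cong vs λ d → trans
      (𝟙-*-cong (chain? (descents σ) (ℤ.+ 0) d) λ ch →
        𝟙-⇔ (below? (suc k) (act d (σ ⁻¹))) (below? M d) (proj₁ (⇔ d ch)) (proj₂ (⇔ d ch)))
      (ℕ.*-comm (𝟙 (chain? (descents σ) (ℤ.+ 0) d)) _)

    by-sign : (σn>0? : Dec (value (σ ⟨$⟩ at (fromℕ n)) ℤ.> ℤ.+ 0)) →
      ∑ vs (λ d → 𝟙 (chain? (descents σ) (ℤ.+ 0) d) * 𝟙 (below? (suc k) (act d (σ ⁻¹))))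
      ≡ (suc k + n ℕ.∸ (des σ + 𝟙 σn>0?)) C n
    by-sign (yes σn>0) = begin
      ∑ vs (λ d → 𝟙 (chain? (descents σ) (ℤ.+ 0) d) * 𝟙 (below? (suc k) (act d (σ ⁻¹))))
        ≡⟨ replace (suc k) (λ d ch → below-positive σ d ch (suc k) σn>0 ,
                                     below-act σ d ch (suc k) (positive⇒0<n σ σn>0)) ⟩
      ∑ vs (λ d → 𝟙 (below? (suc k) d) * 𝟙 (chain? (descents σ) (ℤ.+ 0) d))
        ≡⟨ chains (suc k) σ (suc k) k refl (ℕ.n≤1+n (suc k)) ⟩
      (k + n ℕ.∸ des σ) C n
        ≡⟨ cong (λ a → (suc k + n ℕ.∸ a) C n) (ℕ.+-comm 1 (des σ)) ⟩
      (suc k + n ℕ.∸ (des σ + 1)) C n ∎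
    by-sign (no σn≯0) = begin
      ∑ vs (λ d → 𝟙 (chain? (descents σ) (ℤ.+ 0) d) * 𝟙 (below? (suc k) (act d (σ ⁻¹))))
        ≡⟨ replace (suc (suc k)) (λ d ch → (λ _ → below-max d) , (λ _ → below-nonpositive σ d ch σn≯0)) ⟩
      ∑ vs (λ d → 𝟙 (below? (suc (suc k)) d) * 𝟙 (chain? (descents σ) (ℤ.+ 0) d))
        ≡⟨ chains (suc k) σ (suc (suc k)) (suc k) refl ℕ.≤-refl ⟩
      (suc k + n ℕ.∸ des σ) C n
        ≡⟨ cong (λ a → (suc k + n ℕ.∸ a) C n) (sym (ℕ.+-identityʳ (des σ))) ⟩
      (suc k + n ℕ.∸ (des σ + 0)) C n ∎

  Φ-des : ∀ n l (f : 𝔅 n → ℕ) → (∀ {σ τ} → σ ≈𝔅 τ → f σ ≡ f τ) →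
          Φ n l f ≡ ∑ (elements n) (λ σ → ((l + n ℕ.∸ des σ) C n) * f σ)
  Φ-des n l f f-cong = begin
    Φ n l f
      ≡⟨ ∑-cong vs (λ v → sym (∑-δ (𝔅-finite n) (sortVec (Vec.map value v)) f f-cong)) ⟩
    ∑ vs (λ v → ∑ (elements n) λ σ → 𝟙 (σ ≟𝔅 sortVec (Vec.map value v)) * f σ)
      ≡⟨ ∑-swap vs (elements n) _ ⟩
    ∑ (elements n) (λ σ → ∑ vs λ v → 𝟙 (σ ≟𝔅 sortVec (Vec.map value v)) * f σ)
      ≡⟨ ∑-cong (elements n) (λ σ → trans (∑-*ʳ (f σ) vs _) (cong (_* f σ) (Φ-count l σ))) ⟩
    ∑ (elements n) (λ σ → ((l + n ℕ.∸ des σ) C n) * f σ) ∎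
    where
    open ≡-Reasoning
    vs = vectors (points l) n

  Ψ-ades : ∀ n k (f : 𝔅 n → ℕ) → (∀ {σ τ} → σ ≈𝔅 τ → f σ ≡ f τ) →
           Ψ n (suc k) f ≡ ∑ (elements n) (λ σ → ((suc k + n ℕ.∸ ades σ) C n) * f σ)
  Ψ-ades n k f f-cong = begin
    Ψ n (suc k) f
      ≡⟨ ∑-cong vs (λ v → cong (𝟙 (below? (suc k) v) *_)
           (sym (∑-δ (𝔅-finite n) (sortVec (Vec.map value v)) f f-cong))) ⟩
    ∑ vs (λ v → 𝟙 (below? (suc k) v) *
      ∑ (elements n) λ σ → 𝟙 (σ ≟𝔅 sortVec (Vec.map value v)) * f σ)
      ≡⟨ ∑-cong vs (λ v → trans (sym (∑-*ˡ (𝟙 (below? (suc k) v)) (elements n) _))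
           (∑-cong (elements n) λ σ → sym (ℕ.*-assoc (𝟙 (below? (suc k) v)) _ (f σ)))) ⟩
    ∑ vs (λ v → ∑ (elements n) λ σ →
      𝟙 (below? (suc k) v) * 𝟙 (σ ≟𝔅 sortVec (Vec.map value v)) * f σ)
      ≡⟨ ∑-swap vs (elements n) _ ⟩
    ∑ (elements n) (λ σ → ∑ vs λ v →
      𝟙 (below? (suc k) v) * 𝟙 (σ ≟𝔅 sortVec (Vec.map value v)) * f σ)
      ≡⟨ ∑-cong (elements n) (λ σ → trans (∑-*ʳ (f σ) vs _) (cong (_* f σ) (Ψ-count k σ))) ⟩
    ∑ (elements n) (λ σ → ((suc k + n ℕ.∸ ades σ) C n) * f σ) ∎
    where
    open ≡-Reasoning
    vs = vectors (points (suc k)) n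

-- Evaluation at natural numbers

open Pairings
open RationalPolynomials
open Counting

ι-inverse : ∀ m .{{_ : NonZero m}} → (ℤ.+ 1 ℚ./ m) ℚ.* ι m ≡ 1ℚ
ι-inverse (suc m) = ℚ.toℚᵘ-injective (ℚᵘ.≃-trans (ℚ.toℚᵘ-homo-* (ℤ.+ 1 ℚ./ suc m) (ι (suc m)))
  (ℚᵘ.≃-trans (ℚᵘ.*-cong (ℚ.toℚᵘ-fromℚᵘ (ℚᵘ.mkℚᵘ (ℤ.+ 1) m)) (ι-ᵘ (suc m)))
    (ℚᵘ.*≡* (cong ℤ.+_ (solve 1 (λ m →
      (con 1 :+ m :+ con 0) :* con 1 := con 1 :* ((con 1 :+ m) :* con 1)) refl m)))))
  where open ℕSolver.+-*-Solver

ι-∸ : ∀ {m j} → j ≤ m → ι (m ℕ.∸ j) ≡ ι m ℚ.- ι j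
ι-∸ {m} {j} j≤m = begin
  ι (m ℕ.∸ j)                     ≡⟨ solve 2 (λ a b → a := a :+ b :- b) refl (ι (m ℕ.∸ j)) (ι j) ⟩
  ι (m ℕ.∸ j) ℚ.+ ι j ℚ.- ι j     ≡⟨ cong (ℚ._- ι j) (sym (ι-+ (m ℕ.∸ j) j)) ⟩
  ι (m ℕ.∸ j ℕ.+ j) ℚ.- ι j       ≡⟨ cong (λ i → ι i ℚ.- ι j) (ℕ.m∸n+n≡m j≤m) ⟩
  ι m ℚ.- ι j                     ∎
  where
  open ≡-Reasoning
  open ℚSolver.+-*-Solver

xPairing : ∀ n → ℚ → Pairing (𝔅-group n) ℚ[𝔅 n ][x]
xPairing n = polynomialPairing (𝔅-group n) (groupAlgebraPairing (𝔅-group n) _≟𝔅_)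

module Evaluation (n : ℕ) (u v : ℚ) where
  private module G = Group (𝔅-group n)
  open RawRing ℚ[𝔅 n ][x,y]

  pairing : Pairing (𝔅-group n) ℚ[𝔅 n ][x,y]
  pairing = polynomialPairing (𝔅-group n) (xPairing n u) v

  open Pairing pairing

  Congruent : {A : Set} → (𝔅 n → A) → Set
  Congruent f = ∀ {σ τ} → σ ≈𝔅 τ → f σ ≡ f τ

  pair-· : ∀ q π F → ⟨ q · π , F ⟩ ≡ q ℚ.* F π
  pair-· q π F = trans
    (eval-constant (𝔅-group n) (xPairing n u) v (Polynomial.constant ℚ[𝔅 n ] ((q , π) ∷ [])) F)
    (trans (eval-constant (𝔅-group n) (groupAlgebraPairing (𝔅-group n) _≟𝔅_) u ((q , π) ∷ []) F)
      (ℚ.+-identityʳ _))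

  record Scalar (p : Carrier) (s : ℚ) : Set where
    constructor mkScalar
    field pair-scalar : ∀ {F} → Congruent F → ⟨ p , F ⟩ ≡ s ℚ.* F G.ε

  open Scalar

  scalar-+ : ∀ {p q s t} → Scalar p s → Scalar q t → Scalar (p + q) (s ℚ.+ t)
  scalar-+ {p} {q} {s} {t} S T = mkScalar λ {F} F-cong → trans (+-pair p q F)
    (trans (cong₂ ℚ._+_ (pair-scalar S F-cong) (pair-scalar T F-cong))
           (sym (ℚ.*-distribʳ-+ (F G.ε) s t)))

  scalar-- : ∀ {p q s t} → Scalar p s → Scalar q t → Scalar (p - q) (s ℚ.- t)
  scalar-- {p} {q} {s} {t} S T = scalar-+ S (mkScalar λ {F} F-cong → trans (neg-pair q F)
    (trans (cong ℚ.-_ (pair-scalar T F-cong)) (ℚ.neg-distribˡ-* t (F G.ε))))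

  pair-scalar-* : ∀ {p s} → Scalar p s → ∀ q {F} → Congruent F → ⟨ p * q , F ⟩ ≡ s ℚ.* ⟨ q , F ⟩
  pair-scalar-* {p} {s} S q {F} F-cong = trans (*-pair p q F) (trans
    (pair-scalar S λ {σ} {τ} σ≈τ → pair-cong q λ h → F-cong (G.∙-congʳ {h} {σ} {τ} σ≈τ))
    (cong (s ℚ.*_) (pair-cong q λ h → F-cong (G.identityˡ h))))

  scalar-* : ∀ {p q s t} → Scalar p s → Scalar q t → Scalar (p * q) (s ℚ.* t)
  scalar-* {p} {q} {s} {t} S T = mkScalar λ {F} F-cong → trans (pair-scalar-* S q F-cong)
    (trans (cong (s ℚ.*_) (pair-scalar T F-cong)) (sym (ℚ.*-assoc s t (F G.ε))))

  scalar-1 : Scalar 1# 1ℚ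
  scalar-1 = mkScalar λ {F} _ → trans (1-pair F) (sym (ℚ.*-identityˡ _))

  scalar-scalar : ∀ q → Scalar (scalar q) q
  scalar-scalar q = mkScalar λ {F} _ → pair-· q G.ε F

  scalar-x : Scalar x u
  scalar-x = mkScalar λ {F} _ → trans
    (eval-constant (𝔅-group n) (xPairing n u) v (Polynomial.variable-t ℚ[𝔅 n ]) F)
    (eval-variable (𝔅-group n) (groupAlgebraPairing (𝔅-group n) _≟𝔅_) u F)

  scalar-y : Scalar y v
  scalar-y = mkScalar λ {F} _ → eval-variable (𝔅-group n) (xPairing n u) v F

  scalar-falling : ∀ {p s} → Scalar p s → ∀ k j f → (∀ i → f i ≡ j ℕ.+ i) →
    Scalar (foldr (λ i r → (p - natural i) * r) 1# (applyUpTo f k)) (falling (s ℚ.- ι j) k)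
  scalar-falling         S zero    j f f≗ = scalar-1
  scalar-falling {p} {s} S (suc k) j f f≗ = scalar-*
    (subst (λ i → Scalar (p - natural i) (s ℚ.- ι j)) (sym (trans (f≗ 0) (ℕ.+-identityʳ j)))
      (scalar-- S (scalar-scalar (ι j))))
    (subst (λ t → Scalar _ (falling t k)) shift
      (scalar-falling S k (suc j) (f ∘ suc) λ i → trans (f≗ (suc i)) (ℕ.+-suc j i)))
    where
    open ℚSolver.+-*-Solver

    shift : s ℚ.- ι (suc j) ≡ s ℚ.- ι j ℚ.- 1ℚ
    shift = trans (cong (λ t → s ℚ.- t) (ι-+ 1 j))
      (solve 2 (λ s j → s :- (con 1ℚ :+ j) := s :- j :- con 1ℚ) refl s (ι j))

  scalar-binomial : ∀ {p} m → Scalar p (ι m) → ∀ k → Scalar (binomial p k) (ι (m C k))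
  scalar-binomial {p} m S k = subst (Scalar (binomial p k)) value-C
    (scalar-* (scalar-scalar ((ℤ.+ 1 ℚ./ (k !)) {{k ℕ.!≢0}}))
              (scalar-falling S k 0 _ λ _ → refl))
    where
    open ≡-Reasoning

    1/k! = (ℤ.+ 1 ℚ./ (k !)) {{k ℕ.!≢0}}

    value-C : 1/k! ℚ.* falling (ι m ℚ.- ι 0) k ≡ ι (m C k)
    value-C = begin
      1/k! ℚ.* falling (ι m ℚ.- ι 0) k     ≡⟨ cong (λ s → 1/k! ℚ.* falling s k) (ℚ.+-identityʳ (ι m)) ⟩
      1/k! ℚ.* falling (ι m) k             ≡⟨ cong (1/k! ℚ.*_) (falling-C m k) ⟩
      1/k! ℚ.* (ι (k !) ℚ.* ι (m C k))     ≡⟨ sym (ℚ.*-assoc 1/k! (ι (k !)) (ι (m C k))) ⟩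
      1/k! ℚ.* ι (k !) ℚ.* ι (m C k)       ≡⟨ cong (ℚ._* ι (m C k)) (ι-inverse (k !) {{k ℕ.!≢0}}) ⟩
      1ℚ ℚ.* ι (m C k)                     ≡⟨ ℚ.*-identityˡ _ ⟩
      ι (m C k)                            ∎

  pair-Σ𝔅 : ∀ p m → Scalar p (ι m) → (d : 𝔅 n → ℕ) → (∀ π → d π ≤ m ℕ.+ n) →
    ∀ {f : 𝔅 n → ℕ} → Congruent f →
    ⟨ Σ𝔅 (λ π → binomial (p + natural n - natural (d π)) n * (1ℚ · π)) , ι ∘ f ⟩
    ≡ ι (∑ (elements n) λ π → ((m ℕ.+ n ℕ.∸ d π) C n) ℕ.* f π)
  pair-Σ𝔅 p m S d d≤ {f} f-cong = go (elements n)
    where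
    open ≡-Reasoning

    c : 𝔅 n → ℕ
    c π = (m ℕ.+ n ℕ.∸ d π) C n

    summand : 𝔅 n → Carrier
    summand π = binomial (p + natural n - natural (d π)) n * (1ℚ · π)

    pair-summand : ∀ π → ⟨ summand π , ι ∘ f ⟩ ≡ ι (c π ℕ.* f π)
    pair-summand π = begin
      ⟨ summand π , ι ∘ f ⟩
        ≡⟨ pair-scalar-* (scalar-binomial (m ℕ.+ n ℕ.∸ d π) shifted n) (1ℚ · π) (cong ι ∘ f-cong) ⟩
      ι (c π) ℚ.* ⟨ 1ℚ · π , ι ∘ f ⟩
        ≡⟨ cong (ι (c π) ℚ.*_) (trans (pair-· 1ℚ π (ι ∘ f)) (ℚ.*-identityˡ _)) ⟩
      ι (c π) ℚ.* ι (f π)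
        ≡⟨ sym (ι-* (c π) (f π)) ⟩
      ι (c π ℕ.* f π) ∎
      where
      shifted : Scalar (p + natural n - natural (d π)) (ι (m ℕ.+ n ℕ.∸ d π))
      shifted = subst (Scalar (p + natural n - natural (d π)))
        (trans (cong (ℚ._- ι (d π)) (sym (ι-+ m n))) (sym (ι-∸ (d≤ π))))
        (scalar-- (scalar-+ S (scalar-scalar (ι n))) (scalar-scalar (ι (d π))))

    go : ∀ πs → ⟨ foldr (λ π r → summand π + r) 0# πs , ι ∘ f ⟩ ≡ ι (∑ πs λ π → c π ℕ.* f π)
    go []       = 0-pair (ι ∘ f)
    go (π ∷ πs) = trans (+-pair (summand π) _ (ι ∘ f))
      (trans (cong₂ ℚ._+_ (pair-summand π) (go πs)) (sym (ι-+ (c π ℕ.* f π) _)))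

  pair-ψ : ∀ k {p} → Scalar p (ι (suc k)) → ∀ {f} → Congruent f →
           ⟨ ψ p , ι ∘ f ⟩ ≡ ι (Ψ n (suc k) f)
  pair-ψ k {p} S {f} f-cong = trans
    (pair-Σ𝔅 p (suc k) S ades (λ π → ℕ.≤-trans (ades≤1+n π) (ℕ.s≤s (ℕ.m≤n+m n k))) f-cong)
    (cong ι (sym (Ψ-ades n k f f-cong)))

  pair-φ : ∀ l {p} → Scalar p (ι l) → ∀ {f} → Congruent f → ⟨ φ p , ι ∘ f ⟩ ≡ ι (Φ n l f)
  pair-φ l {p} S {f} f-cong = trans
    (pair-Σ𝔅 p l S des (λ π → ℕ.≤-trans (des≤n π) (ℕ.m≤n+m n l)) f-cong)
    (cong ι (sym (Φ-des n l f f-cong)))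

  pair-ψφ : ∀ k l {p q r} →
    Scalar p (ι (suc k)) → Scalar q (ι l) → Scalar r (ι (l ℕ.* (suc k ℕ.+ suc k) ℕ.+ suc k)) →
    ∀ {f} → Congruent f → ⟨ ψ p * φ q , ι ∘ f ⟩ ≡ ⟨ ψ r , ι ∘ f ⟩
  pair-ψφ k l {p} {q} {r} P Q R {f} f-cong = begin
    ⟨ ψ p * φ q , ι ∘ f ⟩
      ≡⟨ *-pair (ψ p) (φ q) (ι ∘ f) ⟩
    ⟨ ψ p , (λ σ → ⟨ φ q , (λ τ → ι (f (σ G.∙ τ))) ⟩) ⟩
      ≡⟨ pair-cong (ψ p) (λ σ → pair-φ l Q λ {τ} {υ} τ≈υ → f-cong (G.∙-congˡ {σ} {τ} {υ} τ≈υ)) ⟩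
    ⟨ ψ p , (λ σ → ι (Φ n l λ τ → f (σ G.∙ τ))) ⟩
      ≡⟨ pair-ψ k P (λ {σ} {τ} σ≈τ → ∑-cong (vectors (points l) n) λ w →
           f-cong (G.∙-congʳ {sortVec (Vec.map value w)} {σ} {τ} σ≈τ)) ⟩
    ι (Ψ n (suc k) λ σ → Φ n l λ τ → f (σ G.∙ τ))
      ≡⟨ cong ι (Ψ-Φ n k l f f-cong) ⟩
    ι (Ψ n (l ℕ.* (suc k ℕ.+ suc k) ℕ.+ suc k) f)
      ≡⟨ cong (λ K → ι (Ψ n K f)) 1+K ⟩
    ι (Ψ n (suc (l ℕ.* (suc k ℕ.+ suc k) ℕ.+ k)) f)
      ≡⟨ sym (pair-ψ (l ℕ.* (suc k ℕ.+ suc k) ℕ.+ k) (subst (λ K → Scalar r (ι K)) 1+K R) f-cong) ⟩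
    ⟨ ψ r , ι ∘ f ⟩ ∎
    where
    open ≡-Reasoning
    1+K = ℕ.+-suc (l ℕ.* (suc k ℕ.+ suc k)) k

module _ {n : ℕ} where
  open RawRing ℚ[𝔅 n ][x,y]

  ψφ≈ψ : (u v : ℕ → ℚ) → Injective _≡_ _≡_ u → Injective _≡_ _≡_ v → ∀ {p q r} →
    (∀ k l → Evaluation.Scalar n (u k) (v l) p (ι (suc k))) →
    (∀ k l → Evaluation.Scalar n (u k) (v l) q (ι l)) →
    (∀ k l → Evaluation.Scalar n (u k) (v l) r (ι (l ℕ.* (suc k ℕ.+ suc k) ℕ.+ suc k))) →
    ψ p * φ q ≈ ψ r
  ψφ≈ψ u v u-inj v-inj {p} {q} {r} P Q R j i ρ = begin
    coefficientAt (𝔅-group n) _≟𝔅_ (x-coefficient (y-coefficient (ψ p * φ q) j) i) ρ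
      ≡⟨ coefficientAt-δ (x-coefficient (y-coefficient (ψ p * φ q) j) i) ⟩
    pair (𝔅-group n) _≟𝔅_ (x-coefficient (y-coefficient (ψ p * φ q) j) i) (ι ∘ δ)
      ≡⟨ evalPairing-determines (groupAlgebraPairing (𝔅-group n) _≟𝔅_)
           (y-coefficient (ψ p * φ q) j) (y-coefficient (ψ r) j) (ι ∘ δ) u u-inj
           (λ k → evalPairing-determines (xPairing n (u k)) (ψ p * φ q) (ψ r) (ι ∘ δ) v v-inj
             (λ l → Evaluation.pair-ψφ n (u k) (v l) k l (P k l) (Q k l) (R k l)
               λ {σ} {τ} → δ-cong {σ} {τ}) j) i ⟩
    pair (𝔅-group n) _≟𝔅_ (x-coefficient (y-coefficient (ψ r) j) i) (ι ∘ δ)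
      ≡⟨ sym (coefficientAt-δ (x-coefficient (y-coefficient (ψ r) j) i)) ⟩
    coefficientAt (𝔅-group n) _≟𝔅_ (x-coefficient (y-coefficient (ψ r) j) i) ρ ∎
    where
    open ≡-Reasoning
    y-coefficient = Polynomial.coefficient ℚ[𝔅 n ][x]
    x-coefficient = Polynomial.coefficient ℚ[𝔅 n ]

    δ : 𝔅 n → ℕ
    δ σ = 𝟙 (σ ≟𝔅 ρ)

    δ-cong : ∀ {σ τ} → σ ≈𝔅 τ → δ σ ≡ δ τ
    δ-cong {σ} {τ} σ≈τ = 𝟙-⇔ (σ ≟𝔅 ρ) (τ ≟𝔅 ρ)
      (λ σ≈ρ s → trans (sym (σ≈τ s)) (σ≈ρ s)) (λ τ≈ρ s → trans (σ≈τ s) (τ≈ρ s))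

    coefficientAt-δ : ∀ a → coefficientAt (𝔅-group n) _≟𝔅_ a ρ ≡ pair (𝔅-group n) _≟𝔅_ a (ι ∘ δ)
    coefficientAt-δ a = trans (coefficientAt-pair (𝔅-group n) _≟𝔅_ a ρ)
      (Pairing.pair-cong (groupAlgebraPairing (𝔅-group n) _≟𝔅_) a λ σ → ι-if (does (σ ≟𝔅 ρ)))
      where
      ι-if : ∀ b → (if b then 1ℚ else 0ℚ) ≡ ι (if b then 1 else 0)
      ι-if true  = refl
      ι-if false = refl

theorem1p5 : (n : ℕ) .{{_ : NonZero n}} →
    let open RawRing ℚ[𝔅 n ][x,y] in
    (ψ {n} x * φ y ≈ ψ (natural 2 * x * y + x))
    × (ψ {n} (scalar ½ * x) * φ (scalar ½ * (y - 1#)) ≈ ψ (scalar ½ * (x * y)))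
theorem1p5 n =
  ψφ≈ψ (ι ∘ suc) ι (ℕ.suc-injective ∘ ι-injective) ι-injective
    (λ k l → Evaluation.scalar-x n (ι (suc k)) (ι l))
    (λ k l → Evaluation.scalar-y n (ι (suc k)) (ι l))
    (λ k l → let open Evaluation n (ι (suc k)) (ι l) in
      subst (Scalar (natural 2 * x * y + x)) (value₁ k l)
        (scalar-+ (scalar-* (scalar-* (scalar-scalar (ι 2)) scalar-x) scalar-y) scalar-x)) ,
  ψφ≈ψ (ι ∘ even) (ι ∘ odd′) (even-injective ∘ ι-injective) (odd′-injective ∘ ι-injective)
    (λ k l → let open Evaluation n (ι (even k)) (ι (odd′ l)) in
      subst (Scalar (scalar ½ * x)) (half (suc k)) (scalar-* (scalar-scalar ½) scalar-x))
    (λ k l → let open Evaluation n (ι (even k)) (ι (odd′ l)) in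
      subst (Scalar (scalar ½ * (y - 1#)))
        (trans (cong (½ ℚ.*_) (ι-suc∸1 (l ℕ.+ l))) (half l))
        (scalar-* (scalar-scalar ½) (scalar-- scalar-y scalar-1)))
    (λ k l → let open Evaluation n (ι (even k)) (ι (odd′ l)) in
      subst (Scalar (scalar ½ * (x * y))) (value₂ k l)
        (scalar-* (scalar-scalar ½) (scalar-* scalar-x scalar-y)))
  where
  open RawRing ℚ[𝔅 n ][x,y]
  open ≡-Reasoning

  even odd′ : ℕ → ℕ
  even k = suc k ℕ.+ suc k
  odd′ l = suc (l ℕ.+ l)

  double-injective : ∀ {a b} → a ℕ.+ a ≡ b ℕ.+ b → a ≡ b
  double-injective {a} {b} eq = ℕ.*-cancelˡ-≡ a b 2
    (trans (cong (a ℕ.+_) (ℕ.+-identityʳ a)) (trans eq (cong (b ℕ.+_) (sym (ℕ.+-identityʳ b)))))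

  even-injective : ∀ {a b} → even a ≡ even b → a ≡ b
  even-injective = ℕ.suc-injective ∘ double-injective

  odd′-injective : ∀ {a b} → odd′ a ≡ odd′ b → a ≡ b
  odd′-injective = double-injective ∘ ℕ.suc-injective

  half : ∀ a → ½ ℚ.* ι (a ℕ.+ a) ≡ ι a
  half a = trans (cong (½ ℚ.*_) (ι-+ a a)) (solve 1 (λ a → con ½ :* (a :+ a) := a) refl (ι a))
    where open ℚSolver.+-*-Solver

  value₁ : ∀ k l → ι 2 ℚ.* ι (suc k) ℚ.* ι l ℚ.+ ι (suc k)
                 ≡ ι (l ℕ.* (suc k ℕ.+ suc k) ℕ.+ suc k)
  value₁ k l = begin
    ι 2 ℚ.* ι (suc k) ℚ.* ι l ℚ.+ ι (suc k)
      ≡⟨ cong (λ s → s ℚ.* ι l ℚ.+ ι (suc k)) (sym (ι-* 2 (suc k))) ⟩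
    ι (2 ℕ.* suc k) ℚ.* ι l ℚ.+ ι (suc k)
      ≡⟨ cong (ℚ._+ ι (suc k)) (sym (ι-* (2 ℕ.* suc k) l)) ⟩
    ι (2 ℕ.* suc k ℕ.* l) ℚ.+ ι (suc k)
      ≡⟨ sym (ι-+ (2 ℕ.* suc k ℕ.* l) (suc k)) ⟩
    ι (2 ℕ.* suc k ℕ.* l ℕ.+ suc k)
      ≡⟨ cong ι (solve 2 (λ k l → con 2 :* k :* l :+ k := l :* (k :+ k) :+ k) refl (suc k) l) ⟩
    ι (l ℕ.* (suc k ℕ.+ suc k) ℕ.+ suc k) ∎
    where open ℕSolver.+-*-Solver

  value₂ : ∀ k l → ½ ℚ.* (ι (even k) ℚ.* ι (odd′ l)) ≡ ι (l ℕ.* (suc k ℕ.+ suc k) ℕ.+ suc k)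
  value₂ k l = begin
    ½ ℚ.* (ι (even k) ℚ.* ι (odd′ l))
      ≡⟨ sym (ℚ.*-assoc ½ (ι (even k)) (ι (odd′ l))) ⟩
    ½ ℚ.* ι (even k) ℚ.* ι (odd′ l)
      ≡⟨ cong (ℚ._* ι (odd′ l)) (half (suc k)) ⟩
    ι (suc k) ℚ.* ι (odd′ l)
      ≡⟨ sym (ι-* (suc k) (odd′ l)) ⟩
    ι (suc k ℕ.* odd′ l)
      ≡⟨ cong ι (solve 2 (λ k l → k :* (con 1 :+ (l :+ l)) := l :* (k :+ k) :+ k) refl (suc k) l) ⟩
    ι (l ℕ.* (suc k ℕ.+ suc k) ℕ.+ suc k) ∎
    where open ℕSolver.+-*-Solver
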